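{- Let $G$ and $H$ be connected graphs on $n$ vertices. If $G\geq_s H$ then $\alpha(G)\geq \alpha(H)$.
   Context: All graphs are finite and simple. $\alpha(G)$ is the independence number of $G$ (the maximum size of a set of pairwise non-adjacent vertices). The chromatic symmetric function of a graph $G$ with vertices $v_1,\dots,v_n$ is $X_G=\sum_{\kappa}x_{\kappa(v_1)}\cdots x_{\kappa(v_n)}$, summed over all proper colorings $\kappa:V(G)\to\{1,2,3,\dots\}$; it is a homogeneous symmetric function of degree $n$ over $\mathbb{Q}$. Let $s_\lambda$ be the Schur symmetric functions; $[s_\lambda]F$ denotes the coefficient of $s_\lambda$ in $F$ expanded in this basis, and $F$ is Schur-positive if $[s_\lambda]F\ge 0$ for all $\lambda$. For connected graphs $G,H$ on $n$ vertices (for which $[s_{(1^n)}]X_G$ and $[s_{(1^n)}]X_H$ are positive), set $$X_s(G,H)=X_G-\frac{[s_{(1^n)}]X_G}{[s_{(1^n)}]X_H}X_H,$$ and write $G\geq_s H$ if $X_s(G,H)$ is Schur-positive. -}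

module Defs where

open import Data.Bool.Base using (true; false)
open import Data.Fin.Base using (Fin)
import Data.Fin.Base as Fin
import Data.Fin.Properties as Fin
open import Data.Fin.Subset using (Subset; _∈_; ∣_∣)
open import Data.Fin.Subset.Properties using (_∈?_)
import Data.Integer.Base as ℤ
open import Data.List.Base
  using (List; []; _∷_; [_]; allFin; cartesianProductWith; concat; concatMap;
         filter; foldr; length; map; replicate; upTo)
open import Data.List.Extrema.Nat using (max)
open import Data.List.Relation.Binary.Prefix.Heterogeneous using (Prefix)
open import Data.List.Relation.Binary.Prefix.Heterogeneous.Properties using (prefix?)
open import Data.List.Relation.Unary.All using (All; all?)
open import Data.List.Relation.Unary.Linked using (Linked; linked?)
open import Data.Nat.Base using (ℕ; suc)
import Data.Nat.Base as ℕ
import Data.Nat.Properties as ℕ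
open import Data.Nat.ListAction using (sum)
open import Data.Product.Base using (Σ-syntax; _×_)
open import Data.Rational.Base using (ℚ; 0ℚ; _+_; _*_; _-_; _÷_; _/_; _≤_; ≢-nonZero)
import Data.Rational.Properties as ℚ
open import Data.Vec.Base using (Vec; []; _∷_; lookup; tabulate; toList)
open import Data.Vec.Properties using (≡-dec)
open import Level using (0ℓ)
open import Relation.Binary.Construct.Closure.ReflexiveTransitive using (Star)
open import Relation.Binary.Core using (Rel)
open import Relation.Binary.Definitions using (Decidable; Irreflexive; Symmetric)
open import Relation.Binary.PropositionalEquality.Core using (_≡_; _≢_)
open import Relation.Nullary.Decidable.Core using (Dec; yes; no; _×-dec_; _→-dec_; ¬?)
open import Relation.Nullary.Negation.Core using (¬_)

-- All vectors of length m with entries from xs, each listed once when xs has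
-- no repetitions.
words : ∀ {A : Set} → List A → (m : ℕ) → List (Vec A m)
words xs ℕ.zero  = [ [] ]
words xs (suc m) = cartesianProductWith _∷_ xs (words xs m)

------------------------------------------------------------------------
-- Graphs

record Graph (n : ℕ) : Set₁ where
  field
    Adj    : Rel (Fin n) 0ℓ
    adj?   : Decidable Adj
    sym    : Symmetric Adj
    irrefl : Irreflexive _≡_ Adj

open Graph public using (Adj; adj?)

Connected : ∀ {n} → Graph n → Set
Connected G = ∀ u v → Star (Adj G) u v

Independent : ∀ {n} → Graph n → Subset n → Set
Independent G S = ∀ u v → u ∈ S → v ∈ S → ¬ Adj G u v

independent? : ∀ {n} (G : Graph n) (S : Subset n) → Dec (Independent G S)
independent? G S = Fin.all? λ u → Fin.all? λ v →
  (u ∈? S) →-dec ((v ∈? S) →-dec ¬? (adj? G u v))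

subsets : ∀ n → List (Subset n)
subsets n = words (true ∷ false ∷ []) n

α : ∀ {n} → Graph n → ℕ
α {n} G = max 0 (map ∣_∣ (filter (independent? G) (subsets n)))

------------------------------------------------------------------------
-- Formal power series in x₁, x₂, … over ℚ

-- F k (a₁ ∷ … ∷ aₖ ∷ []) is the coefficient of x₁^a₁ ⋯ xₖ^aₖ in F; every
-- monomial in the infinitely many variables has this form for some k.
Series : Set
Series = ∀ k → Vec ℕ k → ℚ

-- The exponent vector of the monomial x_{i₁} ⋯ x_{iₘ}.
content : ∀ {k} → List (Fin k) → Vec ℕ k
content xs = tabulate λ i → length (filter (i Fin.≟_) xs)

fromℕ : ℕ → ℚ
fromℕ m = ℤ.+ m / 1

infixl 6 _-ₛ_
infixl 7 _·ₛ_

_-ₛ_ : Series → Series → Series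
(F -ₛ F′) k a = F k a - F′ k a

_·ₛ_ : ℚ → Series → Series
(c ·ₛ F) k a = c * F k a

------------------------------------------------------------------------
-- The chromatic symmetric function

Proper : ∀ {n k} → Graph n → Vec (Fin k) n → Set
Proper G κ = ∀ u v → Adj G u v → lookup κ u ≢ lookup κ v

proper? : ∀ {n k} (G : Graph n) (κ : Vec (Fin k) n) → Dec (Proper G κ)
proper? G κ = Fin.all? λ u → Fin.all? λ v →
  adj? G u v →-dec ¬? (lookup κ u Fin.≟ lookup κ v)

-- A coloring contributing to the coefficient of a monomial in x₁, …, xₖ uses
-- only the colors 1, …, k, so each coefficient is a count of finitely many
-- colorings.
X : ∀ {n} → Graph n → Series
X {n} G k a = fromℕ (length
  (filter (λ κ → ≡-dec ℕ._≟_ (content (toList κ)) a)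
    (filter (proper? G) (words (allFin k) n))))

------------------------------------------------------------------------
-- Partitions

IsPartition : ℕ → List ℕ → Set
IsPartition n λs = Linked ℕ._≥_ λs × All (0 ℕ.<_) λs × sum λs ≡ n

isPartition? : ∀ n λs → Dec (IsPartition n λs)
isPartition? n λs =
  linked? ℕ._≥?_ λs ×-dec all? (0 ℕ.<?_) λs ×-dec (sum λs ℕ.≟ n)

-- A partition of n has at most n parts, each at most n.
partitions : ℕ → List (List ℕ)
partitions n = filter (isPartition? n)
  (concatMap (λ l → map toList (words (upTo (suc n)) l)) (upTo (suc n)))

------------------------------------------------------------------------
-- Schur functions, as generating functions of semistandard Young tableaux

-- A filling is the list of its rows, from top to bottom.
Filling : ℕ → Set
Filling k = List (List (Fin k))

fillings : ∀ k → List ℕ → List (Filling k)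
fillings k []       = [ [] ]
fillings k (m ∷ λs) =
  cartesianProductWith (λ r T → toList r ∷ T) (words (allFin k) m) (fillings k λs)

-- Upper row and the row just below it: each entry of the lower row is larger
-- than the entry above it (and there is such an entry).
ColumnStrict : ∀ {k} → Rel (List (Fin k)) 0ℓ
ColumnStrict upper lower = Prefix Fin._>_ lower upper

SemiStandard : ∀ {k} → Filling k → Set
SemiStandard T = All (Linked Fin._≤_) T × Linked ColumnStrict T

semiStandard? : ∀ {k} (T : Filling k) → Dec (SemiStandard T)
semiStandard? T =
  all? (linked? Fin._≤?_) T ×-dec
  linked? (λ upper lower → prefix? (λ x y → y Fin.<? x) lower upper) T

schur : List ℕ → Series
schur λs k a = fromℕ (length
  (filter (λ T → ≡-dec ℕ._≟_ (content (concat T)) a)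
    (filter semiStandard? (fillings k λs))))

------------------------------------------------------------------------
-- Schur expansions

-- The expansion F = Σ_{λ ⊢ n} [s_λ]F · s_λ of a symmetric function F that is
-- homogeneous of degree n. As the s_λ form a basis, coeff is determined by F
-- on the partitions of n; its values elsewhere are irrelevant.
record SchurExpansion (n : ℕ) (F : Series) : Set where
  field
    coeff   : List ℕ → ℚ
    expands : ∀ k a → F k a ≡
      foldr _+_ 0ℚ (map (λ λs → coeff λs * schur λs k a) (partitions n))

open SchurExpansion public

SchurPositive : ℕ → Series → Set
SchurPositive n F =
  Σ[ e ∈ SchurExpansion n F ] (∀ λs → IsPartition n λs → 0ℚ ≤ coeff e λs)

1^ : ℕ → List ℕ
1^ n = replicate n 1

-- Division with the convention p / 0 = 0. The only denominators of interest,
-- [s_{(1ⁿ)}]X_H, are positive, so the convention is never used for them.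
_÷₀_ : ℚ → ℚ → ℚ
p ÷₀ q with q ℚ.≟ 0ℚ
... | yes _   = 0ℚ
... | no  q≢0 = _÷_ p q {{≢-nonZero q≢0}}

Xₛ : ∀ {n} (G H : Graph n) → SchurExpansion n (X G) → SchurExpansion n (X H) → Series
Xₛ {n} G H eG eH = X G -ₛ (coeff eG (1^ n) ÷₀ coeff eH (1^ n)) ·ₛ X H

-- The expansions of X G and X H exist and are unique, X G and X H being
-- symmetric and homogeneous of degree n; quantifying over them only names
-- the coefficients entering Xₛ.
infix 4 _≥ₛ_

_≥ₛ_ : ∀ {n} → Graph n → Graph n → Set
_≥ₛ_ {n} G H =
  Σ[ eG ∈ SchurExpansion n (X G) ] Σ[ eH ∈ SchurExpansion n (X H) ]
    SchurPositive n (Xₛ G H eG eH)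

-- Let φ F = Σ (−1)^ℓ(a) [x^a] F, over the compositions a of n. Up to the sign (−1)ⁿ it is the pairing
-- of F with eₙ, that is, the coefficient of s_{(1ⁿ)}. Counting tableaux by removing the largest colour
-- (a horizontal strip) gives φ s_λ = 0 for all other λ. Counting colourings by removing the first
-- colour class shows that (−1)ⁿ φ X_G is the number of acyclic orientations of G; only its positivity
-- is needed, and it follows from a recursion on the number of orientations without sinks in a given
-- set. So the scalar c in X_G − c X_H is positive. If H had an independent set I with more than α(G)
-- vertices, the monomial in which one variable has exponent |I| and the others exponent at most 1
-- would occur in X_H but not in X_G, although Schur-positive series have nonnegative coefficients.

{-# OPTIONS --safe #-}
module Submission where

open import Defs
open import Data.Bool.Base using (Bool; true; false; if_then_else_)
import Data.Bool.Properties as Bool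
open import Data.Empty using (⊥-elim)
open import Data.Fin.Base using (Fin; zero; suc; inject₁; punchIn)
import Data.Fin.Base as Fin
import Data.Fin.Properties as Fin
open import Data.Fin.Subset using (Subset; ⁅_⁆; _∪_; _─_; ∣_∣)
import Data.Fin.Subset as S
import Data.Fin.Subset.Properties as S
import Data.Fin.Relation.Unary.Top as Fin using (view; ‵fromℕ; ‵inj₁)
open import Data.List.Base
  using (List; []; _∷_; _++_; map; filter; length; foldr; concat; replicate; head; zipWith; concatMap;
         upTo; downFrom; allFin; cartesianProductWith)
import Data.List.Properties as List
open import Data.List.Relation.Unary.All using (All; []; _∷_; all?)
import Data.List.Relation.Unary.All as All
import Data.List.Relation.Unary.All.Properties as All
open import Data.List.Relation.Unary.Any using (Any; here; there; any?)
open import Data.List.Membership.Propositional using (_∈_)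
import Data.List.Membership.Propositional.Properties as ∈
open import Data.List.Relation.Unary.Linked using (Linked; []; [-]; _∷_; _∷′_; head′; tail; linked?)
open import Data.List.Relation.Binary.Prefix.Heterogeneous using ([]; _∷_)
open import Data.List.Relation.Binary.Prefix.Heterogeneous.Properties using (prefix?)
open import Data.Maybe.Base using (just)
import Data.Maybe.Relation.Binary.Connected as Maybe
open Maybe using (just; just-nothing; connected?)
open import Data.List.Extrema.Nat using (xs≤max; argmax-sel)
open import Data.Nat using (ℕ; _≥_)
open import Data.Nat.Base using (zero; suc)
import Data.Nat.Coprimality as Coprime
import Data.Integer.Base as ℤ
import Data.Integer.Properties as ℤ
import Data.Nat.Base as ℕ
import Data.Nat.Properties as ℕ
open import Data.Nat.ListAction using (sum)
open import Data.Product.Base using (_×_; _,_; proj₁; proj₂; ∃; map₁; uncurry)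
open import Data.Rational.Base using (ℚ; 0ℚ; 1ℚ; _+_; _*_; _-_; -_; _≤_; _<_)
import Data.Rational.Base as ℚ
import Data.Rational.Properties as ℚ
open import Data.Rational.Solver using (module +-*-Solver)
open import Data.Sum.Base using (_⊎_; inj₁; inj₂)
open import Data.Vec.Base using (Vec; []; _∷_; toList; lookup)
import Data.Vec.Base as Vec
import Data.Vec.Properties as Vec
open import Function.Base using (_∘_; id; case_of_)
open import Relation.Binary.Core using (Rel)
import Relation.Binary.Definitions as B
open import Relation.Binary.PropositionalEquality
open import Relation.Nullary.Decidable using (Dec; yes; no; does; ¬?; _×-dec_; _→-dec_; map′; dec-true)
open import Relation.Nullary.Negation.Core using (¬_)
open import Relation.Unary using (Pred; Decidable)
open import Level using (0ℓ)

open ≡-Reasoning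
open +-*-Solver using (solve; _:=_; _:+_; _:*_; :-_; _:-_; con)

-- The expansions in `G ≥ₛ H` are arbitrary data, so anything about their coefficients has to be
-- read off the values of the series. The functional φ comes from eₙ = Σ (-1)^(n-ℓ(a)) h_a, summed
-- over the compositions a of n, together with ⟨F, h_a⟩ = [x^a] F: pairing with eₙ becomes a signed
-- sum of monomial coefficients. For tableaux and colourings alike, summing over all a with k
-- positive entries replaces "has content a" by "uses all k colours", and objects using all colours
-- obey a recursion that removes one colour. The value of φ on s_{(1ⁿ)} does not enter the final
-- step: the same factor multiplies the coefficients of X_G and X_H, so positivity of the two
-- products already makes their quotient positive.

private variable
  A B C P Q R : Set
  k m n : ℕ

-- Sums and indicators

⟦_⟧ : Dec P → ℚ
⟦ d ⟧ = if does d then 1ℚ else 0ℚ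

⟦⟧-yes : (d : Dec P) → P → ⟦ d ⟧ ≡ 1ℚ
⟦⟧-yes (yes _) _ = refl
⟦⟧-yes (no ¬p) p = ⊥-elim (¬p p)

⟦⟧-no : (d : Dec P) → ¬ P → ⟦ d ⟧ ≡ 0ℚ
⟦⟧-no (yes p) ¬p = ⊥-elim (¬p p)
⟦⟧-no (no _)  _  = refl

⟦⟧-cong : (p? : Dec P) (q? : Dec Q) → (P → Q) → (Q → P) → ⟦ p? ⟧ ≡ ⟦ q? ⟧
⟦⟧-cong (yes p) q? f g = sym (⟦⟧-yes q? (f p))
⟦⟧-cong (no ¬p) q? f g = sym (⟦⟧-no q? (¬p ∘ g))

⟦⟧-× : (r? : Dec R) (p? : Dec P) (q? : Dec Q) → (R → P × Q) → (P → Q → R) →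
       ⟦ r? ⟧ ≡ ⟦ p? ⟧ * ⟦ q? ⟧
⟦⟧-× r? (yes p) q? f g =
  trans (⟦⟧-cong r? q? (proj₂ ∘ f) (g p)) (sym (ℚ.*-identityˡ _))
⟦⟧-× r? (no ¬p) q? f g =
  trans (⟦⟧-no r? (¬p ∘ proj₁ ∘ f)) (sym (ℚ.*-zeroˡ ⟦ q? ⟧))

-- When `P` fails, both sides vanish. Equations that hold only under a condition, such as induction
-- hypotheses, thereby become usable inside a sum weighted by its indicator.
⟦⟧-guard : (d : Dec P) {x y : ℚ} → (P → x ≡ y) → ⟦ d ⟧ * x ≡ ⟦ d ⟧ * y
⟦⟧-guard (yes p) eq = cong (1ℚ *_) (eq p)
⟦⟧-guard (no ¬p) {x} {y} eq = trans (ℚ.*-zeroˡ x) (sym (ℚ.*-zeroˡ y))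

⟦⟧+⟦¬⟧ : (d : Dec P) (x : ℚ) → ⟦ d ⟧ * x + ⟦ ¬? d ⟧ * x ≡ x
⟦⟧+⟦¬⟧ (yes _) x = trans (cong₂ _+_ (ℚ.*-identityˡ x) (ℚ.*-zeroˡ x)) (ℚ.+-identityʳ x)
⟦⟧+⟦¬⟧ (no _)  x = trans (cong₂ _+_ (ℚ.*-zeroˡ x) (ℚ.*-identityˡ x)) (ℚ.+-identityˡ x)

∑ : List A → (A → ℚ) → ℚ
∑ xs f = foldr _+_ 0ℚ (map f xs)

syntax ∑ xs (λ x → e) = ∑[ x ← xs ] e

∑-cong-All : {f g : A → ℚ} {xs : List A} → All (λ x → f x ≡ g x) xs → ∑ xs f ≡ ∑ xs g
∑-cong-All []         = refl
∑-cong-All (eq ∷ eqs) = cong₂ _+_ eq (∑-cong-All eqs)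

∑-cong : {f g : A → ℚ} (xs : List A) → (∀ x → f x ≡ g x) → ∑ xs f ≡ ∑ xs g
∑-cong xs eq = ∑-cong-All (All.universal eq xs)

∑-zero : {f : A → ℚ} (xs : List A) → (∀ x → f x ≡ 0ℚ) → ∑ xs f ≡ 0ℚ
∑-zero []       eq = refl
∑-zero (x ∷ xs) eq = cong₂ _+_ (eq x) (∑-zero xs eq)

∑-+ : (f g : A → ℚ) (xs : List A) → ∑[ x ← xs ] (f x + g x) ≡ ∑ xs f + ∑ xs g
∑-+ f g []       = refl
∑-+ f g (x ∷ xs) = trans (cong (f x + g x +_) (∑-+ f g xs))
  (solve 4 (λ a b c d → (a :+ b) :+ (c :+ d) := (a :+ c) :+ (b :+ d)) refl (f x) (g x) _ _)

∑-*ˡ : (c : ℚ) (f : A → ℚ) (xs : List A) → ∑[ x ← xs ] (c * f x) ≡ c * ∑ xs f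
∑-*ˡ c f []       = sym (ℚ.*-zeroʳ c)
∑-*ˡ c f (x ∷ xs) =
  trans (cong (c * f x +_) (∑-*ˡ c f xs)) (sym (ℚ.*-distribˡ-+ c (f x) _))

∑-*ʳ : (c : ℚ) (f : A → ℚ) (xs : List A) → ∑[ x ← xs ] (f x * c) ≡ ∑ xs f * c
∑-*ʳ c f xs = trans (∑-cong xs λ x → ℚ.*-comm (f x) c) (trans (∑-*ˡ c f xs) (ℚ.*-comm c _))

∑-nonNeg : {f : A → ℚ} {xs : List A} → All (λ x → 0ℚ ≤ f x) xs → 0ℚ ≤ ∑ xs f
∑-nonNeg []       = ℚ.≤-refl
∑-nonNeg (p ∷ ps) = ℚ.+-mono-≤ p (∑-nonNeg ps)

∑-++ : (f : A → ℚ) (xs ys : List A) → ∑ (xs ++ ys) f ≡ ∑ xs f + ∑ ys f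
∑-++ f []       ys = sym (ℚ.+-identityˡ _)
∑-++ f (x ∷ xs) ys = trans (cong (f x +_) (∑-++ f xs ys)) (sym (ℚ.+-assoc (f x) _ _))

∑-map : (f : B → ℚ) (g : A → B) (xs : List A) → ∑ (map g xs) f ≡ ∑ xs (f ∘ g)
∑-map f g []       = refl
∑-map f g (x ∷ xs) = cong (f (g x) +_) (∑-map f g xs)

∑-swap : (f : A → B → ℚ) (xs : List A) (ys : List B) →
         ∑[ x ← xs ] ∑[ y ← ys ] f x y ≡ ∑[ y ← ys ] ∑[ x ← xs ] f x y
∑-swap f []       ys = sym (∑-zero ys λ _ → refl)
∑-swap f (x ∷ xs) ys =
  trans (cong (∑ ys (f x) +_) (∑-swap f xs ys)) (sym (∑-+ (f x) _ ys))

∑-cartesianProductWith : (f : C → ℚ) (g : A → B → C) (xs : List A) (ys : List B) →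
  ∑ (cartesianProductWith g xs ys) f ≡ ∑[ x ← xs ] ∑[ y ← ys ] f (g x y)
∑-cartesianProductWith f g []       ys = refl
∑-cartesianProductWith f g (x ∷ xs) ys =
  trans (∑-++ f (map (g x) ys) _)
        (cong₂ _+_ (∑-map f (g x) ys) (∑-cartesianProductWith f g xs ys))

∑-filter : {P : Pred A 0ℓ} (P? : Decidable P) (f : A → ℚ) (xs : List A) →
           ∑ (filter P? xs) f ≡ ∑[ x ← xs ] (⟦ P? x ⟧ * f x)
∑-filter P? f []       = refl
∑-filter P? f (x ∷ xs) with does (P? x)
... | true  = cong₂ _+_ (sym (ℚ.*-identityˡ (f x))) (∑-filter P? f xs)
... | false = trans (∑-filter P? f xs)
  (trans (sym (ℚ.+-identityˡ _)) (cong (_+ _) (sym (ℚ.*-zeroˡ (f x)))))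

fromℕ-suc : ∀ m → fromℕ (suc m) ≡ 1ℚ + fromℕ m
fromℕ-suc m = sym (trans
  -- `fromℕ m` is normalised by a gcd that does not compute for a variable `m`; the addition unfolds
  -- only once it is in constructor form.
  (cong (1ℚ +_) (ℚ.normalize-coprime (Coprime.sym (Coprime.1-coprimeTo m))))
  (cong (λ i → i ℚ./ 1) (cong (ℤ._+_ (ℤ.+ 1)) (ℤ.*-identityʳ (ℤ.+ m)))))

fromℕ-length : (xs : List A) → fromℕ (length xs) ≡ ∑[ _ ← xs ] 1ℚ
fromℕ-length []       = refl
fromℕ-length (x ∷ xs) = trans (fromℕ-suc (length xs)) (cong (1ℚ +_) (fromℕ-length xs))

fromℕ-length-filter : {P : Pred A 0ℓ} (P? : Decidable P) (xs : List A) →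
                      fromℕ (length (filter P? xs)) ≡ ∑[ x ← xs ] ⟦ P? x ⟧
fromℕ-length-filter P? xs = trans (fromℕ-length (filter P? xs))
  (trans (∑-filter P? _ xs) (∑-cong xs λ x → ℚ.*-identityʳ _))

∑-words : (xs : List A) (f : Vec A (suc m) → ℚ) →
          ∑ (words xs (suc m)) f ≡ ∑[ x ← xs ] ∑[ v ← words xs m ] f (x ∷ v)
∑-words {m = m} xs f = ∑-cartesianProductWith f _∷_ xs (words xs m)

∑-allFin-suc : (f : Fin (suc k) → ℚ) → ∑ (allFin (suc k)) f ≡ f zero + ∑[ i ← allFin k ] f (suc i)
∑-allFin-suc {k} f = cong (f zero +_)
  (trans (cong (λ is → ∑ is f) (sym (List.map-tabulate id suc))) (∑-map f suc (allFin k)))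

∑-allFin-last : ∀ k (f : Fin (suc k) → ℚ) →
                ∑ (allFin (suc k)) f ≡ ∑[ i ← allFin k ] f (inject₁ i) + f (Fin.fromℕ k)
∑-allFin-last zero    f = ℚ.+-comm (f zero) 0ℚ
∑-allFin-last (suc k) f = begin
  ∑ (allFin (2 ℕ.+ k)) f
    ≡⟨ ∑-allFin-suc f ⟩
  f zero + ∑[ i ← allFin (suc k) ] f (suc i)
    ≡⟨ cong (f zero +_) (∑-allFin-last k (f ∘ suc)) ⟩
  f zero + (∑[ i ← allFin k ] f (suc (inject₁ i)) + f (Fin.fromℕ (suc k)))
    ≡⟨ ℚ.+-assoc (f zero) _ _ ⟨
  f zero + ∑[ i ← allFin k ] f (suc (inject₁ i)) + f (Fin.fromℕ (suc k))
    ≡⟨ cong (_+ f (Fin.fromℕ (suc k))) (∑-allFin-suc (f ∘ inject₁)) ⟨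
  ∑[ i ← allFin (suc k) ] f (inject₁ i) + f (Fin.fromℕ (suc k)) ∎

-- The truncated sum Σ_{k ≤ N} (-1)^k f k, nested so that a recursion for `f ∘ suc` applies directly
-- to the tail.
alt : ℕ → (ℕ → ℚ) → ℚ
alt zero    f = f 0
alt (suc N) f = f 0 - alt N (f ∘ suc)

alt-cong : ∀ N {f g : ℕ → ℚ} → (∀ k → f k ≡ g k) → alt N f ≡ alt N g
alt-cong zero    eq = eq 0
alt-cong (suc N) eq = cong₂ _-_ (eq 0) (alt-cong N (eq ∘ suc))

alt-zero : ∀ N → alt N (λ _ → 0ℚ) ≡ 0ℚ
alt-zero zero    = refl
alt-zero (suc N) = cong (λ x → 0ℚ - x) (alt-zero N)

alt-+ : ∀ N (f g : ℕ → ℚ) → alt N (λ k → f k + g k) ≡ alt N f + alt N g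
alt-+ zero    f g = refl
alt-+ (suc N) f g = trans (cong (λ x → f 0 + g 0 - x) (alt-+ N (f ∘ suc) (g ∘ suc)))
  (solve 4 (λ a b c d → (a :+ b) :- (c :+ d) := (a :- c) :+ (b :- d)) refl (f 0) (g 0) _ _)

alt-*ˡ : ∀ N c (f : ℕ → ℚ) → alt N (λ k → c * f k) ≡ c * alt N f
alt-*ˡ zero    c f = refl
alt-*ˡ (suc N) c f = trans (cong (λ x → c * f 0 - x) (alt-*ˡ N c (f ∘ suc)))
  (solve 3 (λ c a b → c :* a :- c :* b := c :* (a :- b)) refl c (f 0) _)

alt-∑ : ∀ N (c : A → ℚ) (f : A → ℕ → ℚ) (xs : List A) →
        alt N (λ k → ∑[ x ← xs ] (c x * f x k)) ≡ ∑[ x ← xs ] (c x * alt N (f x))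
alt-∑ N c f []       = alt-zero N
alt-∑ N c f (x ∷ xs) = trans (alt-+ N _ _) (cong₂ _+_ (alt-*ˡ N (c x) (f x)) (alt-∑ N c f xs))

-- Signed sums over compositions

parts : ℕ → List ℕ
parts n = map suc (downFrom n)

∑-parts-≡ : m ℕ.≤ n → ∑[ j ← parts n ] ⟦ m ℕ.≟ j ⟧ ≡ ⟦ 0 ℕ.<? m ⟧
∑-parts-≡ {zero}  {n} _ = trans (∑-map _ suc (downFrom n)) (∑-zero (downFrom n) λ _ → refl)
∑-parts-≡ {suc m} {n} m<n = trans (∑-map _ suc (downFrom n)) (go n m<n)
  where
  above : ∀ n → n ℕ.≤ m → ∑[ j ← downFrom n ] ⟦ suc m ℕ.≟ suc j ⟧ ≡ 0ℚ
  above zero    _   = refl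
  above (suc n) n<m = cong₂ _+_ (⟦⟧-no (suc m ℕ.≟ suc n) λ eq → ℕ.<-irrefl (sym (ℕ.suc-injective eq)) n<m)
                                (above n (ℕ.<⇒≤ n<m))

  go : ∀ n → m ℕ.< n → ∑[ j ← downFrom n ] ⟦ suc m ℕ.≟ suc j ⟧ ≡ 1ℚ
  go (suc n) m<1+n with m ℕ.≟ n
  ... | yes refl = cong₂ _+_ (⟦⟧-yes (suc m ℕ.≟ suc m) refl) (above m ℕ.≤-refl)
  ... | no  m≢n  = cong₂ _+_ (⟦⟧-no (suc m ℕ.≟ suc n) (m≢n ∘ ℕ.suc-injective))
                             (go n (ℕ.≤∧≢⇒< (ℕ.s≤s⁻¹ m<1+n) m≢n))

∑-words-≡ : (c : Vec ℕ k) → (∀ i → lookup c i ℕ.≤ n) →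
  ∑[ a ← words (parts n) k ] ⟦ Vec.≡-dec ℕ._≟_ c a ⟧ ≡ ⟦ Fin.all? (λ i → 0 ℕ.<? lookup c i) ⟧
∑-words-≡ [] _ = refl
∑-words-≡ {suc k} {n} (m ∷ c) c≤n = begin
  ∑[ a ← words (parts n) (suc k) ] ⟦ Vec.≡-dec ℕ._≟_ (m ∷ c) a ⟧
    ≡⟨ ∑-words (parts n) _ ⟩
  ∑[ j ← parts n ] ∑[ a ← words (parts n) k ] ⟦ Vec.≡-dec ℕ._≟_ (m ∷ c) (j ∷ a) ⟧
    ≡⟨ ∑-cong (parts n) (λ j → ∑-cong (words (parts n) k) λ a →
         ⟦⟧-× (Vec.≡-dec ℕ._≟_ (m ∷ c) (j ∷ a)) (m ℕ.≟ j) (Vec.≡-dec ℕ._≟_ c a)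
              Vec.∷-injective (cong₂ _∷_)) ⟩
  ∑[ j ← parts n ] ∑[ a ← words (parts n) k ] (⟦ m ℕ.≟ j ⟧ * ⟦ Vec.≡-dec ℕ._≟_ c a ⟧)
    ≡⟨ ∑-cong (parts n) (λ j → ∑-*ˡ ⟦ m ℕ.≟ j ⟧ _ (words (parts n) k)) ⟩
  ∑[ j ← parts n ] (⟦ m ℕ.≟ j ⟧ * ∑[ a ← words (parts n) k ] ⟦ Vec.≡-dec ℕ._≟_ c a ⟧)
    ≡⟨ ∑-*ʳ _ _ (parts n) ⟩
  ∑[ j ← parts n ] ⟦ m ℕ.≟ j ⟧ * ∑[ a ← words (parts n) k ] ⟦ Vec.≡-dec ℕ._≟_ c a ⟧
    ≡⟨ cong₂ _*_ (∑-parts-≡ (c≤n zero)) (∑-words-≡ c (c≤n ∘ suc)) ⟩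
  ⟦ 0 ℕ.<? m ⟧ * ⟦ Fin.all? (λ i → 0 ℕ.<? lookup c i) ⟧
    ≡⟨ ⟦⟧-× (Fin.all? λ i → 0 ℕ.<? lookup (m ∷ c) i) (0 ℕ.<? m) (Fin.all? λ i → 0 ℕ.<? lookup c i)
            (λ pos → pos zero , pos ∘ suc) (λ p ps → λ { zero → p ; (suc i) → ps i }) ⟨
  ⟦ Fin.all? (λ i → 0 ℕ.<? lookup (m ∷ c) i) ⟧ ∎

Full : List (Fin k) → Set
Full xs = ∀ i → i ∈ xs

full? : (xs : List (Fin k)) → Dec (Full xs)
full? xs = Fin.all? λ i → any? (i Fin.≟_) xs

lookup-content : (xs : List (Fin k)) (i : Fin k) →
                 lookup (content xs) i ≡ length (filter (i Fin.≟_) xs)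
lookup-content xs i = Vec.lookup∘tabulate _ i

length-filter>0 : {P : Pred A 0ℓ} (P? : Decidable P) {x : A} {xs : List A} →
                  x ∈ xs → P x → 0 ℕ.< length (filter P? xs)
length-filter>0 P? x∈xs px = ∈.∈-length (∈.∈-filter⁺ P? x∈xs px)

content>0⇒Full : (xs : List (Fin k)) → (∀ i → 0 ℕ.< lookup (content xs) i) → Full xs
content>0⇒Full xs pos i = go (filter (i Fin.≟_) xs) (λ x∈ → ∈.∈-filter⁻ (i Fin.≟_) x∈)
  (subst (0 ℕ.<_) (lookup-content xs i) (pos i))
  where
  go : ∀ ys → (∀ {x} → x ∈ ys → x ∈ xs × i ≡ x) → 0 ℕ.< length ys → i ∈ xs
  go (y ∷ ys) sub _ with sub (here refl)
  ... | y∈xs , refl = y∈xs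

Full⇒content>0 : (xs : List (Fin k)) → Full xs → ∀ i → 0 ℕ.< lookup (content xs) i
Full⇒content>0 xs full i = subst (0 ℕ.<_) (sym (lookup-content xs i))
  (length-filter>0 (i Fin.≟_) (full i) refl)

-- After exchanging the sums, each object is counted once for every vector with entries in 1, ..., n
-- that equals its content: once if all colours occur, never otherwise. The bound on the word length
-- keeps the multiplicities within `parts n`.
∑-content : (word : A → List (Fin k)) {ts : List A} → All (λ t → length (word t) ℕ.≤ n) ts →
  ∑[ a ← words (parts n) k ]
    fromℕ (length (filter (λ t → Vec.≡-dec ℕ._≟_ (content (word t)) a) ts))
  ≡ ∑[ t ← ts ] ⟦ full? (word t) ⟧
∑-content {k = k} {n = n} word {ts} bounded = begin
  ∑[ a ← words (parts n) k ]
    fromℕ (length (filter (λ t → Vec.≡-dec ℕ._≟_ (content (word t)) a) ts))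
    ≡⟨ ∑-cong (words (parts n) k) (λ a → fromℕ-length-filter _ ts) ⟩
  ∑[ a ← words (parts n) k ] ∑[ t ← ts ] ⟦ Vec.≡-dec ℕ._≟_ (content (word t)) a ⟧
    ≡⟨ ∑-swap _ (words (parts n) k) ts ⟩
  ∑[ t ← ts ] ∑[ a ← words (parts n) k ] ⟦ Vec.≡-dec ℕ._≟_ (content (word t)) a ⟧
    ≡⟨ ∑-cong-All (All.map (λ {t} → count t) bounded) ⟩
  ∑[ t ← ts ] ⟦ full? (word t) ⟧ ∎
  where
  count : ∀ t → length (word t) ℕ.≤ n →
    ∑[ a ← words (parts n) k ] ⟦ Vec.≡-dec ℕ._≟_ (content (word t)) a ⟧ ≡ ⟦ full? (word t) ⟧
  count t ≤n = trans
    (∑-words-≡ (content (word t)) λ i → ℕ.≤-trans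
      (subst (ℕ._≤ length (word t)) (sym (lookup-content (word t) i))
        (List.length-filter (i Fin.≟_) (word t))) ≤n)
    (⟦⟧-cong (Fin.all? _) (full? (word t)) (content>0⇒Full (word t)) (Full⇒content>0 (word t)))

⟦linked⟧-∷ : {_~_ : Rel A 0ℓ} (R? : B.Decidable _~_) (x : A) (xs : List A) →
  ⟦ linked? R? (x ∷ xs) ⟧ ≡ ⟦ connected? R? (just x) (head xs) ⟧ * ⟦ linked? R? xs ⟧
⟦linked⟧-∷ R? x xs = ⟦⟧-× (linked? R? (x ∷ xs)) (connected? R? (just x) (head xs)) (linked? R? xs)
  (λ l → head′ l , tail l) _∷′_

⟦all⟧-∷ : {P : Pred A 0ℓ} (P? : Decidable P) (x : A) (xs : List A) →
  ⟦ all? P? (x ∷ xs) ⟧ ≡ ⟦ P? x ⟧ * ⟦ all? P? xs ⟧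
⟦all⟧-∷ P? x xs = ⟦⟧-× (all? P? (x ∷ xs)) (P? x) (all? P? xs) (λ { (p ∷ ps) → p , ps }) _∷_

-- Removing the largest colour from rows

splits : ℕ → List (ℕ × ℕ)
splits zero    = (0 , 0) ∷ []
splits (suc m) = (0 , suc m) ∷ map (map₁ suc) (splits m)

∑-splits-suc : ∀ m (f : ℕ × ℕ → ℚ) →
  ∑ (splits (suc m)) f ≡ f (0 , suc m) + ∑[ p ← splits m ] f (map₁ suc p)
∑-splits-suc m f = cong (f (0 , suc m) +_) (∑-map f (map₁ suc) (splits m))

∑-splits-0 : ∀ m (f : ℕ × ℕ → ℚ) → (∀ j b → f (suc j , b) ≡ 0ℚ) → ∑ (splits m) f ≡ f (0 , m)
∑-splits-0 zero    f _   = ℚ.+-identityʳ _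
∑-splits-0 (suc m) f f≡0 = trans (∑-splits-suc m f)
  (trans (cong (f (0 , suc m) +_) (∑-zero (splits m) λ p → f≡0 _ _)) (ℚ.+-identityʳ _))

extend : List (Fin k) → ℕ → List (Fin (suc k))
extend {k} r b = map inject₁ r ++ replicate b (Fin.fromℕ k)

sorted? : (r : List (Fin k)) → Dec (Linked Fin._≤_ r)
sorted? = linked? Fin._≤?_

∑rows : ∀ k → ℕ → (List (Fin k) → ℚ) → ℚ
∑rows k m w = ∑[ r ← words (allFin k) m ] (⟦ sorted? (toList r) ⟧ * w (toList r))

∑rows-cong : ∀ {w w′ : List (Fin k) → ℚ} → (∀ r → length r ≡ m → w r ≡ w′ r) →
             ∑rows k m w ≡ ∑rows k m w′
∑rows-cong {k} {m} eq = ∑-cong (words (allFin k) m) λ r →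
  cong (⟦ sorted? (toList r) ⟧ *_) (eq (toList r) (Vec.length-toList r))

∑rows-∑ : (f : A → List (Fin k) → ℚ) (xs : List A) →
          ∑rows k m (λ r → ∑[ x ← xs ] f x r) ≡ ∑[ x ← xs ] ∑rows k m (f x)
∑rows-∑ {k = k} {m = m} f xs = trans
  (∑-cong (words (allFin k) m) λ r → sym (∑-*ˡ ⟦ sorted? (toList r) ⟧ _ xs))
  (∑-swap _ (words (allFin k) m) xs)

∑rows-* : (c : ℚ) (w : List (Fin k) → ℚ) → ∑rows k m (λ r → c * w r) ≡ c * ∑rows k m w
∑rows-* {k} {m} c w = trans
  (∑-cong (words (allFin k) m) λ r →
    solve 3 (λ s c w → s :* (c :* w) := c :* (s :* w)) refl ⟦ sorted? (toList r) ⟧ c _)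
  (∑-*ˡ c _ (words (allFin k) m))

∑rows-0 : (w : List (Fin k) → ℚ) → ∑rows k 0 w ≡ w []
∑rows-0 w = trans (ℚ.+-identityʳ _) (ℚ.*-identityˡ (w []))

∑rows-suc : ∀ m (w : List (Fin k) → ℚ) → ∑rows k (suc m) w ≡
  ∑[ x ← allFin k ] ∑rows k m (λ r → ⟦ connected? Fin._≤?_ (just x) (head r) ⟧ * w (x ∷ r))
∑rows-suc {k} m w = trans (∑-words (allFin k) _)
  (∑-cong (allFin k) λ x → ∑-cong (words (allFin k) m) λ r → trans
    (cong (_* w (x ∷ toList r)) (⟦linked⟧-∷ Fin._≤?_ x (toList r)))
    (solve 3 (λ a b c → (a :* b) :* c := b :* (a :* c)) refl
      ⟦ connected? Fin._≤?_ (just x) (head (toList r)) ⟧ ⟦ sorted? (toList r) ⟧ _))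

inject₁≤top : (i : Fin k) → inject₁ i Fin.≤ Fin.fromℕ k
inject₁≤top {k} i = Fin.≤fromℕ (inject₁ i)

inject₁<top : (i : Fin k) → inject₁ i Fin.< Fin.fromℕ k
inject₁<top {k} i = subst₂ ℕ._<_ (sym (Fin.toℕ-inject₁ i)) (sym (Fin.toℕ-fromℕ k)) (Fin.toℕ<n i)

connected-extend : (x : Fin k) (r : List (Fin k)) (b : ℕ) →
  ⟦ connected? Fin._≤?_ (just (inject₁ x)) (head (extend r b)) ⟧ ≡
  ⟦ connected? Fin._≤?_ (just x) (head r) ⟧
connected-extend x []      zero    = refl
connected-extend {k} x []      (suc b) = ⟦⟧-yes (connected? Fin._≤?_ (just (inject₁ x)) (head (extend {k = k} [] (suc b)))) (just (inject₁≤top x))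
connected-extend x (y ∷ r) b       = ⟦⟧-cong (connected? Fin._≤?_ (just (inject₁ x)) (just (inject₁ y))) (connected? Fin._≤?_ (just x) (just y))
  (λ { (just le) → just (subst₂ ℕ._≤_ (Fin.toℕ-inject₁ x) (Fin.toℕ-inject₁ y) le) })
  (λ { (just le) → just (subst₂ ℕ._≤_ (sym (Fin.toℕ-inject₁ x)) (sym (Fin.toℕ-inject₁ y)) le) })

connected-top : ∀ k b → ⟦ connected? Fin._≤?_ (just (Fin.fromℕ k)) (head (extend {k} [] b)) ⟧ ≡ 1ℚ
connected-top k zero    = refl
connected-top k (suc b) = ⟦⟧-yes (connected? Fin._≤?_ (just (Fin.fromℕ k)) (just (Fin.fromℕ k))) (just ℕ.≤-refl)

-- A weakly increasing row ends in its block of largest colours. The induction looks at the first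
-- entry: a smaller one lengthens the part that is kept, while a largest one forces the whole row to
-- be largest, so only the split keeping nothing survives.
∑rows-extend : ∀ m (w : List (Fin (suc k)) → ℚ) →
  ∑rows (suc k) m w ≡ ∑[ p ← splits m ] ∑rows k (proj₁ p) (λ r → w (extend r (proj₂ p)))
∑rows-extend {k} zero w = sym (ℚ.+-identityʳ _)
∑rows-extend {k} (suc m) w = begin
  ∑rows (suc k) (suc m) w
    ≡⟨ ∑rows-suc m w ⟩
  ∑[ x ← allFin (suc k) ] ∑rows (suc k) m (w′ x)
    ≡⟨ ∑-cong (allFin (suc k)) (λ x → ∑rows-extend m (w′ x)) ⟩
  ∑[ x ← allFin (suc k) ] ∑[ p ← splits m ] ∑rows k (proj₁ p) (λ r → w′ x (extend r (proj₂ p)))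
    ≡⟨ ∑-allFin-last k (λ x → ∑[ p ← splits m ] ∑rows k (proj₁ p) (λ r → w′ x (extend r (proj₂ p)))) ⟩
  ∑[ x ← allFin k ] ∑[ p ← splits m ] ∑rows k (proj₁ p) (λ r → w′ (inject₁ x) (extend r (proj₂ p)))
    + ∑[ p ← splits m ] ∑rows k (proj₁ p) (λ r → w′ (Fin.fromℕ k) (extend r (proj₂ p)))
    ≡⟨ cong₂ _+_ small large ⟩
  ∑[ p ← splits m ] ∑rows k (suc (proj₁ p)) (λ r → w (extend r (proj₂ p)))
    + ∑rows k 0 (λ r → w (extend r (suc m)))
    ≡⟨ ℚ.+-comm _ (∑rows k 0 (λ r → w (extend r (suc m)))) ⟩
  ∑rows k 0 (λ r → w (extend r (suc m)))
    + ∑[ p ← splits m ] ∑rows k (suc (proj₁ p)) (λ r → w (extend r (proj₂ p)))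
    ≡⟨ ∑-splits-suc m (λ p → ∑rows k (proj₁ p) (λ r → w (extend r (proj₂ p)))) ⟨
  ∑[ p ← splits (suc m) ] ∑rows k (proj₁ p) (λ r → w (extend r (proj₂ p))) ∎
  where
  w′ : Fin (suc k) → List (Fin (suc k)) → ℚ
  w′ x r = ⟦ connected? Fin._≤?_ (just x) (head r) ⟧ * w (x ∷ r)

  small : ∑[ x ← allFin k ] ∑[ p ← splits m ] ∑rows k (proj₁ p) (λ r → w′ (inject₁ x) (extend r (proj₂ p)))
        ≡ ∑[ p ← splits m ] ∑rows k (suc (proj₁ p)) (λ r → w (extend r (proj₂ p)))
  small = trans (∑-swap _ (allFin k) (splits m)) (∑-cong (splits m) λ (j , b) → sym (trans
    (∑rows-suc j (λ r → w (extend r b)))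
    (∑-cong (allFin k) λ x → ∑rows-cong {m = j} λ r _ →
      cong (_* w (inject₁ x ∷ extend r b)) (sym (connected-extend x r b)))))

  vanish : ∀ j b → ∑rows k (suc j) (λ r → w′ (Fin.fromℕ k) (extend r b)) ≡ 0ℚ
  vanish j b = trans (∑rows-suc j (λ r → w′ (Fin.fromℕ k) (extend r b))) (∑-zero (allFin k) λ x →
    ∑-zero (words (allFin k) j) λ r → trans
      (cong (λ c → ⟦ sorted? (toList r) ⟧ * (⟦ connected? Fin._≤?_ (just x) (head (toList r)) ⟧ * (c * w (Fin.fromℕ k ∷ extend (x ∷ toList r) b))))
        (⟦⟧-no (connected? Fin._≤?_ (just (Fin.fromℕ k)) (just (inject₁ x))) λ { (just le) → ℕ.<⇒≱ (inject₁<top x) le }))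
      (solve 3 (λ a b c → a :* (b :* (con 0ℚ :* c)) := con 0ℚ) refl ⟦ sorted? (toList r) ⟧
        ⟦ connected? Fin._≤?_ (just x) (head (toList r)) ⟧ (w (Fin.fromℕ k ∷ extend (x ∷ toList r) b))))

  large : ∑[ p ← splits m ] ∑rows k (proj₁ p) (λ r → w′ (Fin.fromℕ k) (extend r (proj₂ p)))
        ≡ ∑rows k 0 (λ r → w (extend r (suc m)))
  large = begin
    ∑[ p ← splits m ] ∑rows k (proj₁ p) (λ r → w′ (Fin.fromℕ k) (extend r (proj₂ p)))
      ≡⟨ ∑-splits-0 m _ vanish ⟩
    ∑rows k 0 (λ r → w′ (Fin.fromℕ k) (extend r m))
      ≡⟨ ∑rows-0 (λ r → w′ (Fin.fromℕ k) (extend r m)) ⟩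
    ⟦ connected? Fin._≤?_ (just (Fin.fromℕ k)) (head (extend [] m)) ⟧ * w (extend [] (suc m))
      ≡⟨ cong (_* w (extend [] (suc m))) (connected-top k m) ⟩
    1ℚ * w (extend [] (suc m))
      ≡⟨ ℚ.*-identityˡ _ ⟩
    w (extend [] (suc m))
      ≡⟨ ∑rows-0 (λ r → w (extend r (suc m))) ⟨
    ∑rows k 0 (λ r → w (extend r (suc m))) ∎

-- Horizontal strips

columnStrict? : B.Decidable (ColumnStrict {k})
columnStrict? upper lower = prefix? (λ x y → y Fin.<? x) lower upper

-- No entry can exceed the largest colour, so whatever lies in the lower row must stand below an old
-- entry of the upper row. The inequality is λᵢ₊₁ ≤ μᵢ, the horizontal strip condition.
columnStrict-extend⁻ : (u l : List (Fin k)) (a b : ℕ) →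
  ColumnStrict (extend u a) (extend l b) → ColumnStrict u l × length l ℕ.+ b ℕ.≤ length u
columnStrict-extend⁻ []      []      a       zero    _        = [] , ℕ.z≤n
columnStrict-extend⁻ []      []      (suc a) (suc b) (lt ∷ _) = ⊥-elim (ℕ.<-irrefl refl lt)
columnStrict-extend⁻ []      (y ∷ l) (suc a) b       (lt ∷ _) = ⊥-elim (ℕ.<-asym lt (inject₁<top y))
columnStrict-extend⁻ (x ∷ u) []      a       zero    _        = [] , ℕ.z≤n
columnStrict-extend⁻ (x ∷ u) []      a       (suc b) (_ ∷ ps) =
  [] , ℕ.s≤s (proj₂ (columnStrict-extend⁻ u [] a b ps))
columnStrict-extend⁻ (x ∷ u) (y ∷ l) a       b       (lt ∷ ps) with columnStrict-extend⁻ u l a b ps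
... | cs , le = subst₂ ℕ._<_ (Fin.toℕ-inject₁ x) (Fin.toℕ-inject₁ y) lt ∷ cs , ℕ.s≤s le

columnStrict-extend⁺ : (u l : List (Fin k)) (a b : ℕ) →
  ColumnStrict u l → length l ℕ.+ b ℕ.≤ length u → ColumnStrict (extend u a) (extend l b)
columnStrict-extend⁺ u       []      a zero    _         _  = []
columnStrict-extend⁺ (x ∷ u) []      a (suc b) _         le =
  inject₁<top x ∷ columnStrict-extend⁺ u [] a b [] (ℕ.s≤s⁻¹ le)
columnStrict-extend⁺ (x ∷ u) (y ∷ l) a b       (lt ∷ cs) le =
  subst₂ ℕ._<_ (sym (Fin.toℕ-inject₁ x)) (sym (Fin.toℕ-inject₁ y)) lt
    ∷ columnStrict-extend⁺ u l a b cs (ℕ.s≤s⁻¹ le)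

extendAll : Filling k → List (ℕ × ℕ) → Filling (suc k)
extendAll = zipWith (λ r p → extend r (proj₂ p))

first : List ℕ → ℕ
first []      = 0
first (m ∷ _) = m

-- The horizontal strips λ/μ, a row of length λᵢ being recorded as (μᵢ , λᵢ − μᵢ).
strips : List ℕ → List (List (ℕ × ℕ))
strips []       = [] ∷ []
strips (m ∷ λs) =
  cartesianProductWith _∷_ (filter (λ p → first λs ℕ.≤? proj₁ p) (splits m)) (strips λs)

inner outer : List (ℕ × ℕ) → List ℕ
inner = map proj₁
outer = map (uncurry ℕ._+_)

All-cartesianProductWith : {P : Pred A 0ℓ} {Q : Pred B 0ℓ} {R : Pred C 0ℓ} {f : A → B → C}
  {xs : List A} {ys : List B} → (∀ {x y} → P x → Q y → R (f x y)) →
  All P xs → All Q ys → All R (cartesianProductWith f xs ys)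
All-cartesianProductWith g []       qs = []
All-cartesianProductWith g (p ∷ ps) qs =
  All.++⁺ (All.map⁺ (All.map (g p) qs)) (All-cartesianProductWith g ps qs)

splits-+ : ∀ m → All (λ p → proj₁ p ℕ.+ proj₂ p ≡ m) (splits m)
splits-+ zero    = refl ∷ []
splits-+ (suc m) = refl ∷ All.map⁺ (All.map (cong suc) (splits-+ m))

first-mono : ∀ qs → first (inner qs) ℕ.≤ first (outer qs)
first-mono []      = ℕ.z≤n
first-mono (q ∷ _) = ℕ.m≤m+n _ _

linked-∷-≥ : ∀ {j ms} → first ms ℕ.≤ j → Linked ℕ._≥_ ms → Linked ℕ._≥_ (j ∷ ms)
linked-∷-≥ {ms = []}    _  _ = [-]
linked-∷-≥ {ms = _ ∷ _} le l = le ∷ l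

-- The interlacing μᵢ₊₁ ≤ λᵢ₊₁ ≤ μᵢ makes the inner shape weakly decreasing again, as the induction
-- in `altTableaux` requires.
strips-shape : ∀ λs → All (λ ps → outer ps ≡ λs × Linked ℕ._≥_ (inner ps)) (strips λs)
strips-shape []       = (refl , []) ∷ []
strips-shape (m ∷ λs) = All-cartesianProductWith
  (λ { {_} {qs} (le , +≡m) (≡λs , l) → cong₂ _∷_ +≡m ≡λs ,
       linked-∷-≥ (ℕ.≤-trans (first-mono qs) (subst (λ μ → first μ ℕ.≤ _) (sym ≡λs) le)) l })
  (All.zip (All.all-filter _ (splits m) , All.filter⁺ _ (splits-+ m)))
  (strips-shape λs)

fillings-shape : ∀ λs → All (λ T → map length T ≡ λs) (fillings k λs)
fillings-shape []       = refl ∷ []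
fillings-shape {k} (m ∷ λs) = All-cartesianProductWith (λ {r} r≡m ≡λs → cong₂ _∷_ r≡m ≡λs)
  (All.universal Vec.length-toList (words (allFin k) m)) (fillings-shape λs)

∑tableaux : ∀ k → List ℕ → (Filling k → ℚ) → ℚ
∑tableaux k λs w = ∑[ T ← fillings k λs ] (⟦ semiStandard? T ⟧ * w T)

∑tableaux-cong : ∀ {λs} {w w′ : Filling k → ℚ} → (∀ T → map length T ≡ λs → w T ≡ w′ T) →
                 ∑tableaux k λs w ≡ ∑tableaux k λs w′
∑tableaux-cong {k} {λs} eq = ∑-cong-All
  (All.map (λ {T} sh → cong (⟦ semiStandard? T ⟧ *_) (eq T sh)) (fillings-shape λs))

∑tableaux-* : ∀ {λs} (c : ℚ) (w : Filling k → ℚ) →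
              ∑tableaux k λs (λ T → c * w T) ≡ c * ∑tableaux k λs w
∑tableaux-* {k} {λs} c w = trans
  (∑-cong (fillings k λs) λ T →
    solve 3 (λ s c w → s :* (c :* w) := c :* (s :* w)) refl ⟦ semiStandard? T ⟧ c (w T))
  (∑-*ˡ c _ (fillings k λs))

below? : (r : List (Fin k)) (T : Filling k) → Dec (Maybe.Connected ColumnStrict (just r) (head T))
below? r T = connected? columnStrict? (just r) (head T)

⟦semiStandard⟧-∷ : (r : List (Fin k)) (T : Filling k) →
  ⟦ semiStandard? (r ∷ T) ⟧ ≡ ⟦ sorted? r ⟧ * (⟦ semiStandard? T ⟧ * ⟦ below? r T ⟧)
⟦semiStandard⟧-∷ r T = trans
  (⟦⟧-× (semiStandard? (r ∷ T)) (sorted? r) (semiStandard? T ×-dec below? r T)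
    (λ { (s ∷ ss , l) → s , (ss , tail l) , head′ l })
    (λ { s ((ss , l) , b) → s ∷ ss , b ∷′ l }))
  (cong (⟦ sorted? r ⟧ *_) (⟦⟧-× (semiStandard? T ×-dec below? r T) (semiStandard? T) (below? r T) id _,_))

∑tableaux-∷ : ∀ m λs (w : Filling k → ℚ) → ∑tableaux k (m ∷ λs) w ≡
  ∑rows k m (λ r → ∑tableaux k λs (λ T → ⟦ below? r T ⟧ * w (r ∷ T)))
∑tableaux-∷ {k} m λs w = trans
  (∑-cartesianProductWith _ (λ r T → toList r ∷ T) (words (allFin k) m) (fillings k λs))
  (∑-cong (words (allFin k) m) λ r → trans
    (∑-cong (fillings k λs) λ T → trans
      (cong (_* w (toList r ∷ T)) (⟦semiStandard⟧-∷ (toList r) T))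
      (solve 4 (λ a b c d → (a :* (b :* c)) :* d := a :* (b :* (c :* d))) refl
        ⟦ sorted? (toList r) ⟧ ⟦ semiStandard? T ⟧ ⟦ below? (toList r) T ⟧ (w (toList r ∷ T))))
    (∑-*ˡ ⟦ sorted? (toList r) ⟧ _ (fillings k λs)))

-- The condition on the new boxes separates from the condition on the old entries and depends on the
-- shapes alone. It can therefore leave the sum over tableaux, where it becomes the filter in
-- `strips`.
⟦below⟧-extend : ∀ (r : List (Fin k)) b (T : Filling k) qs → map length T ≡ inner qs →
  ⟦ below? (extend r b) (extendAll T qs) ⟧ ≡ ⟦ first (outer qs) ℕ.≤? length r ⟧ * ⟦ below? r T ⟧
⟦below⟧-extend r b []      []             _  = sym (ℚ.*-identityˡ 1ℚ)
⟦below⟧-extend r b (l ∷ T) ((j , c) ∷ qs) sh = ⟦⟧-×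
  (below? (extend r b) (extendAll (l ∷ T) ((j , c) ∷ qs)))
  (j ℕ.+ c ℕ.≤? length r) (below? r (l ∷ T))
  (λ { (just cs) → let cs′ , le = columnStrict-extend⁻ r l b c cs
                   in subst (λ i → i ℕ.+ c ℕ.≤ length r) l≡j le , just cs′ })
  (λ { le (just cs) → just (columnStrict-extend⁺ r l b c cs
         (subst (λ i → i ℕ.+ c ℕ.≤ length r) (sym l≡j) le)) })
  where
  l≡j : length l ≡ j
  l≡j = List.∷-injectiveˡ sh

-- Removing the largest colour from the tableaux of shape λ leaves the tableaux of the shapes μ
-- for which λ/μ is a horizontal strip.
∑tableaux-strips : ∀ λs (w : Filling (suc k) → ℚ) → ∑tableaux (suc k) λs w ≡
  ∑[ ps ← strips λs ] ∑tableaux k (inner ps) (λ T → w (extendAll T ps))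
∑tableaux-strips []       w = sym (ℚ.+-identityʳ _)
∑tableaux-strips {k} (m ∷ λs) w = begin
  ∑tableaux (suc k) (m ∷ λs) w
    ≡⟨ ∑tableaux-∷ m λs w ⟩
  ∑rows (suc k) m (λ r → ∑tableaux (suc k) λs (w′ r))
    ≡⟨ ∑rows-cong {m = m} {w = λ r → ∑tableaux (suc k) λs (w′ r)} (λ r _ → ∑tableaux-strips λs (w′ r)) ⟩
  ∑rows (suc k) m (λ r → ∑[ qs ← strips λs ] lower qs r)
    ≡⟨ ∑rows-extend m (λ r → ∑[ qs ← strips λs ] lower qs r) ⟩
  ∑[ p ← splits m ] ∑rows k (proj₁ p) (λ r → ∑[ qs ← strips λs ] peel p qs r)
    ≡⟨ ∑-cong (splits m) (λ p → ∑rows-∑ {m = proj₁ p} (peel p) (strips λs)) ⟩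
  ∑[ p ← splits m ] ∑[ qs ← strips λs ] ∑rows k (proj₁ p) (peel p qs)
    ≡⟨ ∑-cong (splits m) (λ p → trans
         (∑-cong-All (All.map (λ {qs} sh → pull p qs (proj₁ sh)) (strips-shape λs)))
         (∑-*ˡ ⟦ first λs ℕ.≤? proj₁ p ⟧ (λ qs → new (p ∷ qs)) (strips λs))) ⟩
  ∑[ p ← splits m ] (⟦ first λs ℕ.≤? proj₁ p ⟧ * ∑[ qs ← strips λs ] new (p ∷ qs))
    ≡⟨ ∑-filter fits? (λ p → ∑[ qs ← strips λs ] new (p ∷ qs)) (splits m) ⟨
  ∑[ p ← filter fits? (splits m) ] ∑[ qs ← strips λs ] new (p ∷ qs)
    ≡⟨ ∑-cartesianProductWith new _∷_ (filter fits? (splits m)) (strips λs) ⟨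
  ∑ (strips (m ∷ λs)) new ∎
  where
  fits? : (p : ℕ × ℕ) → Dec (first λs ℕ.≤ proj₁ p)
  fits? p = first λs ℕ.≤? proj₁ p

  new : List (ℕ × ℕ) → ℚ
  new ps = ∑tableaux k (inner ps) (λ T → w (extendAll T ps))

  w′ : List (Fin (suc k)) → Filling (suc k) → ℚ
  w′ r T = ⟦ below? r T ⟧ * w (r ∷ T)

  lower : List (ℕ × ℕ) → List (Fin (suc k)) → ℚ
  lower qs r = ∑tableaux k (inner qs) (λ T → w′ r (extendAll T qs))

  peel : ℕ × ℕ → List (ℕ × ℕ) → List (Fin k) → ℚ
  peel (_ , b) qs r = lower qs (extend r b)

  pull : ∀ p qs → outer qs ≡ λs →
         ∑rows k (proj₁ p) (peel p qs) ≡ ⟦ fits? p ⟧ * new (p ∷ qs)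
  pull (j , b) qs refl = begin
    ∑rows k j (peel (j , b) qs)
      ≡⟨ ∑rows-cong {m = j} step ⟩
    ∑rows k j (λ r → ⟦ first λs ℕ.≤? j ⟧ * upper r)
      ≡⟨ ∑rows-* {m = j} ⟦ first λs ℕ.≤? j ⟧ upper ⟩
    ⟦ first λs ℕ.≤? j ⟧ * ∑rows k j upper
      ≡⟨ cong (⟦ first λs ℕ.≤? j ⟧ *_) (∑tableaux-∷ j (inner qs) (λ T → w (extendAll T ((j , b) ∷ qs)))) ⟨
    ⟦ first λs ℕ.≤? j ⟧ * new ((j , b) ∷ qs) ∎
    where
    rest : List (Fin k) → Filling k → ℚ
    rest r T = ⟦ below? r T ⟧ * w (extend r b ∷ extendAll T qs)

    upper : List (Fin k) → ℚ
    upper r = ∑tableaux k (inner qs) (rest r)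

    step : ∀ r → length r ≡ j → peel (j , b) qs r ≡ ⟦ first λs ℕ.≤? j ⟧ * upper r
    step r refl = trans
      (∑tableaux-cong {λs = inner qs} {w = λ T → w′ (extend r b) (extendAll T qs)} λ T sh → trans
        (cong (_* w (extend r b ∷ extendAll T qs)) (⟦below⟧-extend r b T qs sh))
        (ℚ.*-assoc ⟦ first λs ℕ.≤? length r ⟧ ⟦ below? r T ⟧ _))
      (∑tableaux-* {λs = inner qs} ⟦ first λs ℕ.≤? length r ⟧ (rest r))

-- Signed sums over tableaux

Grows : List (ℕ × ℕ) → Set
Grows = Any (λ p → 0 ℕ.< proj₂ p)

grows? : ∀ ps → Dec (Grows ps)
grows? = any? (λ p → 0 ℕ.<? proj₂ p)

∈-extend⁻ : ∀ {y} (r : List (Fin k)) b → y ∈ extend r b →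
            (∃ λ x → x ∈ r × y ≡ inject₁ x) ⊎ (0 ℕ.< b × y ≡ Fin.fromℕ k)
∈-extend⁻ {k} r b y∈ with ∈.∈-++⁻ (map inject₁ r) y∈
... | inj₁ y∈r = inj₁ (∈.∈-map⁻ inject₁ y∈r)
∈-extend⁻ {k} r (suc b) y∈ | inj₂ y∈b = inj₂ (ℕ.z<s , All.lookup (All.replicate⁺ {P = _≡ Fin.fromℕ k} (suc b) refl) y∈b)

∈-extendAll⁻ : ∀ {y} (T : Filling k) ps → y ∈ concat (extendAll T ps) →
               (∃ λ x → x ∈ concat T × y ≡ inject₁ x) ⊎ (Grows ps × y ≡ Fin.fromℕ k)
∈-extendAll⁻ []      _              ()
∈-extendAll⁻ (r ∷ T) []             ()
∈-extendAll⁻ (r ∷ T) ((_ , b) ∷ ps) y∈ with ∈.∈-++⁻ (extend r b) y∈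
... | inj₁ y∈r with ∈-extend⁻ r b y∈r
...   | inj₁ (x , x∈ , eq) = inj₁ (x , ∈.∈-++⁺ˡ x∈ , eq)
...   | inj₂ (b>0 , eq)    = inj₂ (here b>0 , eq)
∈-extendAll⁻ (r ∷ T) ((_ , b) ∷ ps) y∈ | inj₂ y∈T with ∈-extendAll⁻ T ps y∈T
...   | inj₁ (x , x∈ , eq) = inj₁ (x , ∈.∈-++⁺ʳ r x∈ , eq)
...   | inj₂ (g , eq)      = inj₂ (there g , eq)

inject₁-∈-extendAll : ∀ {x} (T : Filling k) ps → length T ≡ length ps →
                      x ∈ concat T → inject₁ x ∈ concat (extendAll T ps)
inject₁-∈-extendAll (r ∷ T) ((_ , b) ∷ ps) len x∈ with ∈.∈-++⁻ r x∈
... | inj₁ x∈r = ∈.∈-++⁺ˡ (∈.∈-++⁺ˡ (∈.∈-map⁺ inject₁ x∈r))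
... | inj₂ x∈T = ∈.∈-++⁺ʳ (extend r b) (inject₁-∈-extendAll T ps (ℕ.suc-injective len) x∈T)

top-∈-extendAll : (T : Filling k) (ps : List (ℕ × ℕ)) → length T ≡ length ps →
                  Grows ps → Fin.fromℕ k ∈ concat (extendAll T ps)
top-∈-extendAll (r ∷ T) ((_ , suc b) ∷ ps) len (here _)  = ∈.∈-++⁺ˡ (∈.∈-++⁺ʳ (map inject₁ r) (here refl))
top-∈-extendAll (r ∷ T) ((_ , b) ∷ ps)     len (there g) =
  ∈.∈-++⁺ʳ (extend r b) (top-∈-extendAll T ps (ℕ.suc-injective len) g)

inject₁≢top : (i : Fin k) → inject₁ i ≢ Fin.fromℕ k
inject₁≢top i eq = Fin.fromℕ≢inject₁ (sym eq)

-- The largest colour occurs exactly when some row gains a box, and the other colours come from `T`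
-- only. The lengths must agree because `zipWith` truncates.
⟦full⟧-extendAll : (T : Filling k) (ps : List (ℕ × ℕ)) → length T ≡ length ps →
  ⟦ full? (concat (extendAll T ps)) ⟧ ≡ ⟦ grows? ps ⟧ * ⟦ full? (concat T) ⟧
⟦full⟧-extendAll {k} T ps len =
  ⟦⟧-× (full? (concat (extendAll T ps))) (grows? ps) (full? (concat T)) to from
  where
  to : Full (concat (extendAll T ps)) → Grows ps × Full (concat T)
  to full = grows , λ i → below i (∈-extendAll⁻ T ps (full (inject₁ i)))
    where
    below : ∀ i → (∃ λ x → x ∈ concat T × inject₁ i ≡ inject₁ x) ⊎ (Grows ps × inject₁ i ≡ Fin.fromℕ k) →
            i ∈ concat T
    below i (inj₁ (x , x∈ , eq)) = subst (_∈ concat T) (sym (Fin.inject₁-injective eq)) x∈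
    below i (inj₂ (_ , eq))      = ⊥-elim (inject₁≢top i eq)

    grows : Grows ps
    grows with ∈-extendAll⁻ T ps (full (Fin.fromℕ k))
    ... | inj₁ (x , _ , eq) = ⊥-elim (inject₁≢top x (sym eq))
    ... | inj₂ (g , _)      = g

  from : Grows ps → Full (concat T) → Full (concat (extendAll T ps))
  from g full i with Fin.view i
  ... | Fin.‵fromℕ     = top-∈-extendAll T ps len g
  ... | Fin.‵inj₁ {i = j} _ = inject₁-∈-extendAll T ps len (full j)

surjTableaux : List ℕ → ℕ → ℚ
surjTableaux λs k = ∑tableaux k λs (λ T → ⟦ full? (concat T) ⟧)

surjTableaux-suc : ∀ λs k → surjTableaux λs (suc k) ≡
                   ∑[ ps ← strips λs ] (⟦ grows? ps ⟧ * surjTableaux (inner ps) k)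
surjTableaux-suc λs k = trans (∑tableaux-strips λs (λ T → ⟦ full? (concat T) ⟧))
  (∑-cong (strips λs) λ ps → trans
    (∑tableaux-cong {λs = inner ps} {w = λ T → ⟦ full? (concat (extendAll T ps)) ⟧} λ T sh →
      ⟦full⟧-extendAll T ps (trans (sym (List.length-map length T)) (trans (cong length sh) (List.length-map proj₁ ps))))
    (∑tableaux-* {λs = inner ps} ⟦ grows? ps ⟧ (λ T → ⟦ full? (concat T) ⟧)))

-- Inner shapes keep the number of rows of the outer shape, so trailing zeros occur and the empty
-- shape is any list of zeros.
empty? : ∀ λs → Dec (All (_≡ 0) λs)
empty? = all? (ℕ._≟ 0)

surjTableaux-zero : ∀ λs → surjTableaux λs 0 ≡ ⟦ empty? λs ⟧
surjTableaux-zero []           = refl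
surjTableaux-zero (zero ∷ λs)  = begin
  surjTableaux (0 ∷ λs) 0
    ≡⟨ ∑tableaux-∷ 0 λs _ ⟩
  ∑rows 0 0 w
    ≡⟨ ∑rows-0 w ⟩
  w []
    ≡⟨ ∑tableaux-cong {λs = λs} {w = λ T → ⟦ below? [] T ⟧ * ⟦ full? (concat ([] ∷ T)) ⟧}
         (λ T _ → trans (cong (_* 1ℚ) (⟦⟧-yes (below? [] T) (below T))) (ℚ.*-identityˡ 1ℚ)) ⟩
  surjTableaux λs 0
    ≡⟨ surjTableaux-zero λs ⟩
  ⟦ empty? λs ⟧
    ≡⟨ ℚ.*-identityˡ ⟦ empty? λs ⟧ ⟨
  1ℚ * ⟦ empty? λs ⟧
    ≡⟨ ⟦all⟧-∷ (ℕ._≟ 0) 0 λs ⟨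
  ⟦ empty? (0 ∷ λs) ⟧ ∎
  where
  w : List (Fin 0) → ℚ
  w r = ∑tableaux 0 λs (λ T → ⟦ below? r T ⟧ * ⟦ full? (concat (r ∷ T)) ⟧)

  below : (T : Filling 0) → Maybe.Connected ColumnStrict (just []) (head T)
  below []       = just-nothing
  below ([] ∷ T) = just []
-- There is no row of positive length over the empty alphabet, so the right side of this equation
-- computes to 0, as does the indicator.
surjTableaux-zero (suc m ∷ λs) = ∑tableaux-∷ {0} (suc m) λs (λ T → ⟦ full? (concat T) ⟧)

altTableaux-suc : ∀ N λs → alt (suc N) (surjTableaux λs) ≡
  ⟦ empty? λs ⟧ - ∑[ ps ← strips λs ] (⟦ grows? ps ⟧ * alt N (surjTableaux (inner ps)))
altTableaux-suc N λs = cong₂ _-_ (surjTableaux-zero λs)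
  (trans (alt-cong N (surjTableaux-suc λs))
         (alt-∑ N (λ ps → ⟦ grows? ps ⟧) (λ ps → surjTableaux (inner ps)) (strips λs)))

-- Cancellation outside single columns

partSign : ℕ → ℚ
partSign 0             = 1ℚ
partSign 1             = - 1ℚ
partSign (suc (suc _)) = 0ℚ

-- On weakly decreasing lists this is (-1)^i for the column (1^i), trailing zeros allowed, and 0 for
-- every other shape. In product form its sum over horizontal strips factors over the rows; by the
-- Pieri rule that sum expresses Σ (-1)^i e_i h_{m-i} = 0 for m > 0.
columnSign : List ℕ → ℚ
columnSign = foldr (λ m x → partSign m * x) 1ℚ

-- For m > 0 the first two terms cancel and the others are zero. In the sum over strips the full
-- range 0, ..., m is available for a row only if the row below is empty; if the rows below are not
-- all zero, their own factor already vanishes.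
∑-splits-partSign : ∀ m → ∑[ p ← splits m ] partSign (proj₁ p) ≡ ⟦ m ℕ.≟ 0 ⟧
∑-splits-partSign zero          = refl
∑-splits-partSign (suc zero)    = refl
∑-splits-partSign (suc (suc m)) = begin
  ∑[ p ← splits (2 ℕ.+ m) ] partSign (proj₁ p)
    ≡⟨ ∑-splits-suc (suc m) (λ p → partSign (proj₁ p)) ⟩
  1ℚ + ∑[ p ← splits (suc m) ] partSign (suc (proj₁ p))
    ≡⟨ cong (1ℚ +_) (∑-splits-0 (suc m) (λ p → partSign (suc (proj₁ p))) λ _ _ → refl) ⟩
  0ℚ ∎

-- The sum factors over the rows: row i contributes the sum of partSign over [λᵢ₊₁ , λᵢ].
∑-strips-columnSign : ∀ λs → ∑[ ps ← strips λs ] columnSign (inner ps) ≡ ⟦ empty? λs ⟧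
∑-strips-columnSign []       = refl
∑-strips-columnSign (m ∷ λs) = begin
  ∑[ ps ← strips (m ∷ λs) ] columnSign (inner ps)
    ≡⟨ ∑-cartesianProductWith _ _∷_ ps (strips λs) ⟩
  ∑[ p ← ps ] ∑[ qs ← strips λs ] (partSign (proj₁ p) * columnSign (inner qs))
    ≡⟨ ∑-cong ps (λ p → trans (∑-*ˡ (partSign (proj₁ p)) (λ qs → columnSign (inner qs)) (strips λs))
         (cong (partSign (proj₁ p) *_) (∑-strips-columnSign λs))) ⟩
  ∑[ p ← ps ] (partSign (proj₁ p) * ⟦ empty? λs ⟧)
    ≡⟨ ∑-*ʳ ⟦ empty? λs ⟧ _ ps ⟩
  ∑[ p ← ps ] partSign (proj₁ p) * ⟦ empty? λs ⟧
    ≡⟨ ℚ.*-comm _ ⟦ empty? λs ⟧ ⟩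
  ⟦ empty? λs ⟧ * ∑[ p ← ps ] partSign (proj₁ p)
    ≡⟨ ⟦⟧-guard (empty? λs) (λ λ≡0 → trans (∑-filter _ _ (splits m)) (trans
         (∑-cong (splits m) λ p → trans
           (cong (_* partSign (proj₁ p)) (⟦⟧-yes (first λs ℕ.≤? proj₁ p) (first≤ λ≡0)))
           (ℚ.*-identityˡ (partSign (proj₁ p))))
         (∑-splits-partSign m))) ⟩
  ⟦ empty? λs ⟧ * ⟦ m ℕ.≟ 0 ⟧
    ≡⟨ ℚ.*-comm ⟦ empty? λs ⟧ ⟦ m ℕ.≟ 0 ⟧ ⟩
  ⟦ m ℕ.≟ 0 ⟧ * ⟦ empty? λs ⟧
    ≡⟨ ⟦all⟧-∷ (ℕ._≟ 0) m λs ⟨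
  ⟦ empty? (m ∷ λs) ⟧ ∎
  where
  ps : List (ℕ × ℕ)
  ps = filter (λ p → first λs ℕ.≤? proj₁ p) (splits m)

  first≤ : ∀ {μ j} → All (_≡ 0) μ → first μ ℕ.≤ j
  first≤ []         = ℕ.z≤n
  first≤ (refl ∷ _) = ℕ.z≤n

∑-splits-last : ∀ m (f : ℕ → ℚ) → ∑[ p ← splits m ] (⟦ ¬? (0 ℕ.<? proj₂ p) ⟧ * f (proj₁ p)) ≡ f m
∑-splits-last zero    f = trans (ℚ.+-identityʳ _) (ℚ.*-identityˡ (f 0))
∑-splits-last (suc m) f = begin
  ∑[ p ← splits (suc m) ] (⟦ ¬? (0 ℕ.<? proj₂ p) ⟧ * f (proj₁ p))
    ≡⟨ ∑-splits-suc m (λ p → ⟦ ¬? (0 ℕ.<? proj₂ p) ⟧ * f (proj₁ p)) ⟩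
  0ℚ * f 0 + ∑[ p ← splits m ] (⟦ ¬? (0 ℕ.<? proj₂ p) ⟧ * f (suc (proj₁ p)))
    ≡⟨ cong₂ _+_ (ℚ.*-zeroˡ (f 0)) (∑-splits-last m (λ j → f (suc j))) ⟩
  0ℚ + f (suc m)
    ≡⟨ ℚ.+-identityˡ (f (suc m)) ⟩
  f (suc m) ∎

first≤head : ∀ {m λs} → Linked ℕ._≥_ (m ∷ λs) → first λs ℕ.≤ m
first≤head [-]      = ℕ.z≤n
first≤head (le ∷ _) = le

-- Only the trivial strip λ/λ has no box, and it passes the filter in `strips` because λ is weakly
-- decreasing. The function `f` is arbitrary so that the induction can prepend the first row to its
-- argument.
∑-strips-¬grows : ∀ λs → Linked ℕ._≥_ λs → (f : List ℕ → ℚ) →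
                  ∑[ ps ← strips λs ] (⟦ ¬? (grows? ps) ⟧ * f (inner ps)) ≡ f λs
∑-strips-¬grows []       _ f = trans (ℚ.+-identityʳ _) (ℚ.*-identityˡ (f []))
∑-strips-¬grows (m ∷ λs) l f = begin
  ∑[ ps ← strips (m ∷ λs) ] (⟦ ¬? (grows? ps) ⟧ * f (inner ps))
    ≡⟨ ∑-cartesianProductWith (λ ps → ⟦ ¬? (grows? ps) ⟧ * f (inner ps)) _∷_ (filter fits? (splits m)) (strips λs) ⟩
  ∑[ p ← filter fits? (splits m) ] ∑[ qs ← strips λs ] (⟦ ¬? (grows? (p ∷ qs)) ⟧ * f (proj₁ p ∷ inner qs))
    ≡⟨ ∑-cong (filter fits? (splits m)) row ⟩
  ∑[ p ← filter fits? (splits m) ] (⟦ ¬? (0 ℕ.<? proj₂ p) ⟧ * f (proj₁ p ∷ λs))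
    ≡⟨ ∑-filter fits? (λ p → ⟦ ¬? (0 ℕ.<? proj₂ p) ⟧ * f (proj₁ p ∷ λs)) (splits m) ⟩
  ∑[ p ← splits m ] (⟦ fits? p ⟧ * (⟦ ¬? (0 ℕ.<? proj₂ p) ⟧ * f (proj₁ p ∷ λs)))
    ≡⟨ ∑-cong (splits m) (λ p → solve 3 (λ a b c → a :* (b :* c) := b :* (a :* c)) refl
         ⟦ fits? p ⟧ ⟦ ¬? (0 ℕ.<? proj₂ p) ⟧ (f (proj₁ p ∷ λs))) ⟩
  ∑[ p ← splits m ] (⟦ ¬? (0 ℕ.<? proj₂ p) ⟧ * (⟦ fits? p ⟧ * f (proj₁ p ∷ λs)))
    ≡⟨ ∑-splits-last m (λ j → ⟦ first λs ℕ.≤? j ⟧ * f (j ∷ λs)) ⟩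
  ⟦ first λs ℕ.≤? m ⟧ * f (m ∷ λs)
    ≡⟨ cong (_* f (m ∷ λs)) (⟦⟧-yes (first λs ℕ.≤? m) (first≤head l)) ⟩
  1ℚ * f (m ∷ λs)
    ≡⟨ ℚ.*-identityˡ (f (m ∷ λs)) ⟩
  f (m ∷ λs) ∎
  where
  fits? : (p : ℕ × ℕ) → Dec (first λs ℕ.≤ proj₁ p)
  fits? p = first λs ℕ.≤? proj₁ p

  row : ∀ p → ∑[ qs ← strips λs ] (⟦ ¬? (grows? (p ∷ qs)) ⟧ * f (proj₁ p ∷ inner qs)) ≡
              ⟦ ¬? (0 ℕ.<? proj₂ p) ⟧ * f (proj₁ p ∷ λs)
  row p@(j , b) = trans
    (∑-cong (strips λs) λ qs → trans
      (cong (_* f (j ∷ inner qs)) (⟦⟧-× (¬? (grows? (p ∷ qs))) (¬? (0 ℕ.<? b)) (¬? (grows? qs))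
        (λ ¬g → ¬g ∘ here , ¬g ∘ there) (λ { ¬h ¬t (here h) → ¬h h ; ¬h ¬t (there t) → ¬t t })))
      (ℚ.*-assoc ⟦ ¬? (0 ℕ.<? b) ⟧ ⟦ ¬? (grows? qs) ⟧ (f (j ∷ inner qs))))
    (trans (∑-*ˡ ⟦ ¬? (0 ℕ.<? b) ⟧ (λ qs → ⟦ ¬? (grows? qs) ⟧ * f (j ∷ inner qs)) (strips λs))
           (cong (⟦ ¬? (0 ℕ.<? b) ⟧ *_) (∑-strips-¬grows λs (tail l) (λ μ → f (j ∷ μ)))))

sum-inner≤ : ∀ ps → sum (inner ps) ℕ.≤ sum (outer ps)
sum-inner≤ []             = ℕ.z≤n
sum-inner≤ ((j , b) ∷ ps) = ℕ.+-mono-≤ (ℕ.m≤m+n j b) (sum-inner≤ ps)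

sum-inner< : ∀ {ps} → Grows ps → sum (inner ps) ℕ.< sum (outer ps)
sum-inner< {(j , suc b) ∷ ps} (here _)  = ℕ.+-mono-<-≤ (ℕ.m<m+n j ℕ.z<s) (sum-inner≤ ps)
sum-inner< {(j , b) ∷ ps}     (there g) = ℕ.+-mono-≤-< (ℕ.m≤m+n j b) (sum-inner< g)

columnSign-0 : ∀ {λs} → All (_≡ 0) λs → columnSign λs ≡ 1ℚ
columnSign-0 []           = refl
columnSign-0 (refl ∷ λ≡0) = trans (ℚ.*-identityˡ _) (columnSign-0 λ≡0)

sum≡0⇒empty : ∀ λs → sum λs ℕ.≤ 0 → All (_≡ 0) λs
sum≡0⇒empty []       _  = []
sum≡0⇒empty (m ∷ λs) le = ℕ.n≤0⇒n≡0 (ℕ.m+n≤o⇒m≤o m le) ∷ sum≡0⇒empty λs (ℕ.m+n≤o⇒n≤o m le)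

-- Removing the largest colour expresses the left side through the strips with at least one box. By
-- induction these contribute the sum of `columnSign` over all strips, which is the indicator of the
-- empty shape, minus the term of λ/λ; the indicators cancel and `columnSign λs` remains.
altTableaux : ∀ N λs → Linked ℕ._≥_ λs → sum λs ℕ.≤ N → alt N (surjTableaux λs) ≡ columnSign λs
altTableaux zero    λs l le = trans (surjTableaux-zero λs)
  (trans (⟦⟧-yes (empty? λs) λ≡0) (sym (columnSign-0 λ≡0)))
  where λ≡0 = sum≡0⇒empty λs le
altTableaux (suc N) λs l le = begin
  alt (suc N) (surjTableaux λs)
    ≡⟨ altTableaux-suc N λs ⟩
  ⟦ empty? λs ⟧ - ∑[ ps ← strips λs ] (⟦ grows? ps ⟧ * alt N (surjTableaux (inner ps)))
    ≡⟨ cong₂ _-_ (sym split) (∑-cong-All (All.map (λ {ps} → ih ps) (strips-shape λs))) ⟩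
  (∑[ ps ← strips λs ] (⟦ grows? ps ⟧ * columnSign (inner ps)) + columnSign λs)
    - ∑[ ps ← strips λs ] (⟦ grows? ps ⟧ * columnSign (inner ps))
    ≡⟨ solve 2 (λ a b → (a :+ b) :- a := b) refl
         (∑[ ps ← strips λs ] (⟦ grows? ps ⟧ * columnSign (inner ps))) (columnSign λs) ⟩
  columnSign λs ∎
  where
  ih : ∀ ps → outer ps ≡ λs × Linked ℕ._≥_ (inner ps) →
       ⟦ grows? ps ⟧ * alt N (surjTableaux (inner ps)) ≡ ⟦ grows? ps ⟧ * columnSign (inner ps)
  -- A strip with at least one box lowers the size, so the bound `N` suffices for the inner shape.
  ih ps (refl , l′) = ⟦⟧-guard (grows? ps) λ g →
    altTableaux N (inner ps) l′ (ℕ.s≤s⁻¹ (ℕ.≤-trans (sum-inner< g) le))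

  split : ∑[ ps ← strips λs ] (⟦ grows? ps ⟧ * columnSign (inner ps)) + columnSign λs ≡ ⟦ empty? λs ⟧
  split = begin
    ∑[ ps ← strips λs ] (⟦ grows? ps ⟧ * columnSign (inner ps)) + columnSign λs
      ≡⟨ cong (_+_ (∑[ ps ← strips λs ] (⟦ grows? ps ⟧ * columnSign (inner ps)))) (∑-strips-¬grows λs l columnSign) ⟨
    ∑[ ps ← strips λs ] (⟦ grows? ps ⟧ * columnSign (inner ps))
      + ∑[ ps ← strips λs ] (⟦ ¬? (grows? ps) ⟧ * columnSign (inner ps))
      ≡⟨ ∑-+ _ _ (strips λs) ⟨
    ∑[ ps ← strips λs ] (⟦ grows? ps ⟧ * columnSign (inner ps) + ⟦ ¬? (grows? ps) ⟧ * columnSign (inner ps))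
      ≡⟨ ∑-cong (strips λs) (λ ps → ⟦⟧+⟦¬⟧ (grows? ps) (columnSign (inner ps))) ⟩
    ∑[ ps ← strips λs ] columnSign (inner ps)
      ≡⟨ ∑-strips-columnSign λs ⟩
    ⟦ empty? λs ⟧ ∎

columnSign≢0⇒≤1 : ∀ λs → columnSign λs ≢ 0ℚ → All (ℕ._≤ 1) λs
columnSign≢0⇒≤1 []                 _ = []
columnSign≢0⇒≤1 (0 ∷ λs)           s = ℕ.z≤n ∷ columnSign≢0⇒≤1 λs λ eq → s (cong (1ℚ *_) eq)
columnSign≢0⇒≤1 (1 ∷ λs)           s = ℕ.≤-refl ∷ columnSign≢0⇒≤1 λs λ eq → s (cong (- 1ℚ *_) eq)
columnSign≢0⇒≤1 (suc (suc m) ∷ λs) s = ⊥-elim (s (ℚ.*-zeroˡ (columnSign λs)))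

partition-of-1s : ∀ {n λs} → All (0 ℕ.<_) λs → All (ℕ._≤ 1) λs → sum λs ≡ n → λs ≡ 1^ n
partition-of-1s []           []           refl = refl
partition-of-1s (lo ∷ los) (hi ∷ his) refl with ℕ.≤-antisym hi lo
... | refl = cong (1 ∷_) (partition-of-1s los his refl)

length-concat : (xss : List (List A)) → length (concat xss) ≡ sum (map length xss)
length-concat []         = refl
length-concat (xs ∷ xss) = trans (List.length-++ xs) (cong (length xs ℕ.+_) (length-concat xss))

-- The vectors range over all totals, not only n. For F homogeneous of degree n, only compositions
-- of n contribute; their parts are at most n and there are at most n of them, so neither cutoff
-- loses anything.
φ : ℕ → Series → ℚ
φ n F = alt n λ k → ∑ (words (parts n) k) (F k)

φ-schur : ∀ n λs → IsPartition n λs → φ n (schur λs) ≡ columnSign λs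
φ-schur n λs (l , _ , refl) = trans (alt-cong n count) (altTableaux n λs l ℕ.≤-refl)
  where
  size : (T : Filling k) → map length T ≡ λs → length (concat T) ≡ n
  size T sh = trans (length-concat T) (cong sum sh)

  count : ∀ k → ∑ (words (parts n) k) (schur λs k) ≡ surjTableaux λs k
  count k = trans
    (∑-content concat (All.filter⁺ semiStandard?
      (All.map (λ {T} sh → ℕ.≤-reflexive (size T sh)) (fillings-shape λs))))
    (∑-filter semiStandard? (λ T → ⟦ full? (concat T) ⟧) (fillings k λs))

φ-schur-0 : ∀ n λs → IsPartition n λs → λs ≢ 1^ n → φ n (schur λs) ≡ 0ℚ
φ-schur-0 n λs part@(_ , pos , ≡n) ≢1ⁿ with columnSign λs ℚ.≟ 0ℚ
... | yes s≡0 = trans (φ-schur n λs part) s≡0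
... | no  s≢0 = ⊥-elim (≢1ⁿ (partition-of-1s pos (columnSign≢0⇒≤1 λs s≢0) ≡n))

-- Colour classes

∑-subsets-∷ : ∀ n (f : Subset (suc n) → ℚ) → ∑ (subsets (suc n)) f ≡
  ∑[ I ← subsets n ] f (true ∷ I) + ∑[ I ← subsets n ] f (false ∷ I)
∑-subsets-∷ n f = trans (∑-words _ f) (cong (∑ (subsets n) (λ I → f (true ∷ I)) +_) (ℚ.+-identityʳ _))

∑-subsets-split : (v : Fin n) (f : Subset n → ℚ) → ∑ (subsets n) f ≡
  ∑[ I ← subsets n ] (⟦ ¬? (v S.∈? I) ⟧ * (f I + f (⁅ v ⁆ ∪ I)))
∑-subsets-split {suc n} zero f = begin
  ∑ (subsets (suc n)) f
    ≡⟨ ∑-subsets-∷ n f ⟩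
  ∑[ I ← subsets n ] f (true ∷ I) + ∑[ I ← subsets n ] f (false ∷ I)
    ≡⟨ ℚ.+-comm _ (∑[ I ← subsets n ] f (false ∷ I)) ⟩
  ∑[ I ← subsets n ] f (false ∷ I) + ∑[ I ← subsets n ] f (true ∷ I)
    ≡⟨ ∑-+ _ _ (subsets n) ⟨
  ∑[ I ← subsets n ] (f (false ∷ I) + f (true ∷ I))
    ≡⟨ ∑-cong (subsets n) (λ I → sym (trans (ℚ.*-identityˡ _)
         (cong (λ J → f (false ∷ I) + f (true ∷ J)) (S.∪-identityˡ I)))) ⟩
  ∑[ I ← subsets n ] (1ℚ * (f (false ∷ I) + f (true ∷ (S.⊥ ∪ I))))
    ≡⟨ ℚ.+-identityˡ _ ⟨
  0ℚ + ∑[ I ← subsets n ] (1ℚ * (f (false ∷ I) + f (true ∷ (S.⊥ ∪ I))))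
    ≡⟨ cong (_+ ∑[ I ← subsets n ] (1ℚ * (f (false ∷ I) + f (true ∷ (S.⊥ ∪ I)))))
            (∑-zero (subsets n) λ I → ℚ.*-zeroˡ (f (true ∷ I) + f (true ∷ (S.⊥ ∪ I)))) ⟨
  ∑[ I ← subsets n ] (0ℚ * (f (true ∷ I) + f (true ∷ (S.⊥ ∪ I))))
    + ∑[ I ← subsets n ] (1ℚ * (f (false ∷ I) + f (true ∷ (S.⊥ ∪ I))))
    ≡⟨ ∑-subsets-∷ n _ ⟨
  ∑[ I ← subsets (suc n) ] (⟦ ¬? (zero S.∈? I) ⟧ * (f I + f (⁅ zero ⁆ ∪ I))) ∎
∑-subsets-split {suc n} (suc v) f = begin
  ∑ (subsets (suc n)) f
    ≡⟨ ∑-subsets-∷ n f ⟩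
  ∑[ I ← subsets n ] f (true ∷ I) + ∑[ I ← subsets n ] f (false ∷ I)
    ≡⟨ cong₂ _+_ (trans (∑-subsets-split v _) (∑-cong (subsets n) (shift true)))
                 (trans (∑-subsets-split v _) (∑-cong (subsets n) (shift false))) ⟩
  ∑[ I ← subsets n ] g (true ∷ I) + ∑[ I ← subsets n ] g (false ∷ I)
    ≡⟨ ∑-subsets-∷ n g ⟨
  ∑ (subsets (suc n)) g ∎
  where
  g : Subset (suc n) → ℚ
  g I = ⟦ ¬? (suc v S.∈? I) ⟧ * (f I + f (⁅ suc v ⁆ ∪ I))

  shift : ∀ b I → ⟦ ¬? (v S.∈? I) ⟧ * (f (b ∷ I) + f (b ∷ (⁅ v ⁆ ∪ I))) ≡ g (b ∷ I)
  shift b I = cong (_* (f (b ∷ I) + f (b ∷ (⁅ v ⁆ ∪ I))))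
    (⟦⟧-cong (¬? (v S.∈? I)) (¬? (suc v S.∈? (b ∷ I))) (λ v∉ → v∉ ∘ S.drop-there) (λ v∉ → v∉ ∘ Vec.there))

∑-subsets-empty : ∀ n (f : Subset n → ℚ) →
                  ∑[ I ← subsets n ] (⟦ ¬? (S.nonempty? I) ⟧ * f I) ≡ f S.⊥
∑-subsets-empty zero    f = trans (ℚ.+-identityʳ _) (ℚ.*-identityˡ (f []))
∑-subsets-empty (suc n) f = begin
  ∑[ I ← subsets (suc n) ] (⟦ ¬? (S.nonempty? I) ⟧ * f I)
    ≡⟨ ∑-subsets-∷ n (λ I → ⟦ ¬? (S.nonempty? I) ⟧ * f I) ⟩
  ∑[ I ← subsets n ] (⟦ ¬? (S.nonempty? (true ∷ I)) ⟧ * f (true ∷ I))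
    + ∑[ I ← subsets n ] (⟦ ¬? (S.nonempty? (false ∷ I)) ⟧ * f (false ∷ I))
    ≡⟨ cong₂ _+_
         (∑-zero (subsets n) λ I → trans
           (cong (_* f (true ∷ I)) (⟦⟧-no (¬? (S.nonempty? (true ∷ I))) λ ¬ne → ¬ne (zero , Vec.here)))
           (ℚ.*-zeroˡ (f (true ∷ I))))
         (∑-cong (subsets n) λ I → cong (_* f (false ∷ I))
           (⟦⟧-cong (¬? (S.nonempty? (false ∷ I))) (¬? (S.nonempty? I))
             (λ ¬ne (v , v∈) → ¬ne (suc v , Vec.there v∈))
             (λ { ¬ne (suc v , Vec.there v∈) → ¬ne (v , v∈) }))) ⟩
  0ℚ + ∑[ I ← subsets n ] (⟦ ¬? (S.nonempty? I) ⟧ * f (false ∷ I))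
    ≡⟨ ℚ.+-identityˡ _ ⟩
  ∑[ I ← subsets n ] (⟦ ¬? (S.nonempty? I) ⟧ * f (false ∷ I))
    ≡⟨ ∑-subsets-empty n (λ I → f (false ∷ I)) ⟩
  f S.⊥ ∎

-- Colour zero marks the vertices left uncoloured; join I inserts a new first colour, that of I.
joinColour : Bool → Fin (suc k) → Fin (suc (suc k))
joinColour b c = if b then suc zero else punchIn (suc zero) c

join : Subset n → Vec (Fin (suc k)) n → Vec (Fin (suc (suc k))) n
join = Vec.zipWith joinColour

compatibleColour? : (b : Bool) (c : Fin (suc k)) → Dec (b ≡ true → c ≡ zero)
compatibleColour? b c = (b Bool.≟ true) →-dec (c Fin.≟ zero)

Compatible : Subset n → Vec (Fin (suc k)) n → Set
Compatible I κ = ∀ v → lookup I v ≡ true → lookup κ v ≡ zero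

compatible? : (I : Subset n) (κ : Vec (Fin (suc k)) n) → Dec (Compatible I κ)
compatible? I κ = Fin.all? λ v → compatibleColour? (lookup I v) (lookup κ v)

∑-joinColour : ∀ k (f : Fin (suc (suc k)) → ℚ) → ∑ (allFin (suc (suc k))) f ≡
  ∑[ b ← true ∷ false ∷ [] ] ∑[ c ← allFin (suc k) ] (⟦ compatibleColour? b c ⟧ * f (joinColour b c))
∑-joinColour k f = begin
  ∑ (allFin (2 ℕ.+ k)) f
    ≡⟨ trans (∑-allFin-suc f) (cong (f zero +_) (∑-allFin-suc (f ∘ suc))) ⟩
  f zero + (f (suc zero) + ∑[ c ← allFin k ] f (suc (suc c)))
    ≡⟨ solve 3 (λ a b c → a :+ (b :+ c) := (con 1ℚ :* b :+ con 0ℚ) :+ ((con 1ℚ :* a :+ c) :+ con 0ℚ)) refl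
         (f zero) (f (suc zero)) _ ⟩
  (1ℚ * f (suc zero) + 0ℚ) + ((1ℚ * f zero + ∑[ c ← allFin k ] f (suc (suc c))) + 0ℚ)
    ≡⟨ cong₂ (λ x y → (1ℚ * f (suc zero) + x) + ((1ℚ * f zero + y) + 0ℚ))
         (sym (∑-zero (allFin k) λ c → ℚ.*-zeroˡ (f (suc zero))))
         (∑-cong (allFin k) λ c → sym (ℚ.*-identityˡ (f (suc (suc c))))) ⟩
  (1ℚ * f (suc zero) + ∑[ c ← allFin k ] (0ℚ * f (suc zero)))
    + ((1ℚ * f zero + ∑[ c ← allFin k ] (1ℚ * f (suc (suc c)))) + 0ℚ)
    ≡⟨ cong₂ (λ x y → x + (y + 0ℚ))
         (∑-allFin-suc (λ c → ⟦ compatibleColour? true c ⟧ * f (joinColour true c)))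
         (∑-allFin-suc (λ c → ⟦ compatibleColour? false c ⟧ * f (joinColour false c))) ⟨
  ∑[ b ← true ∷ false ∷ [] ] ∑[ c ← allFin (suc k) ] (⟦ compatibleColour? b c ⟧ * f (joinColour b c)) ∎

-- Every vector is `join I κ` for exactly one compatible pair: `I` is the class of colour
-- `suc zero`, and compatibility pins `κ` to zero on `I`, where `join` would ignore its value.
∑-join : ∀ n (f : Vec (Fin (suc (suc k))) n → ℚ) → ∑ (words (allFin (suc (suc k))) n) f ≡
  ∑[ I ← subsets n ] ∑[ κ ← words (allFin (suc k)) n ] (⟦ compatible? I κ ⟧ * f (join I κ))
∑-join zero f = solve 1 (λ a → a :+ con 0ℚ := ((con 1ℚ :* a :+ con 0ℚ) :+ con 0ℚ)) refl (f [])
∑-join {k} (suc n) f = begin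
  ∑ (words (allFin (2 ℕ.+ k)) (suc n)) f
    ≡⟨ ∑-words (allFin (2 ℕ.+ k)) f ⟩
  ∑[ x ← allFin (2 ℕ.+ k) ] ∑[ κ ← words (allFin (2 ℕ.+ k)) n ] f (x ∷ κ)
    ≡⟨ ∑-cong (allFin (2 ℕ.+ k)) (λ x → ∑-join n (λ κ → f (x ∷ κ))) ⟩
  ∑[ x ← allFin (2 ℕ.+ k) ] rest x
    ≡⟨ ∑-joinColour k rest ⟩
  ∑[ b ← bs ] ∑[ c ← cs ] (⟦ compatibleColour? b c ⟧ * rest (joinColour b c))
    ≡⟨ ∑-cong bs (λ b → ∑-cong cs λ c → trans
         (sym (∑-*ˡ ⟦ compatibleColour? b c ⟧ _ (subsets n)))
         (∑-cong (subsets n) λ I → trans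
           (sym (∑-*ˡ ⟦ compatibleColour? b c ⟧ _ (words cs n)))
           (∑-cong (words cs n) λ κ → combine b c I κ))) ⟩
  ∑[ b ← bs ] ∑[ c ← cs ] ∑[ I ← subsets n ] ∑[ κ ← words cs n ] g (b ∷ I) (c ∷ κ)
    ≡⟨ ∑-cong bs (λ b → ∑-swap (λ c I → ∑[ κ ← words cs n ] g (b ∷ I) (c ∷ κ)) cs (subsets n)) ⟩
  ∑[ b ← bs ] ∑[ I ← subsets n ] ∑[ c ← cs ] ∑[ κ ← words cs n ] g (b ∷ I) (c ∷ κ)
    ≡⟨ ∑-cong bs (λ b → ∑-cong (subsets n) λ I → sym (∑-words cs (g (b ∷ I)))) ⟩
  ∑[ b ← bs ] ∑[ I ← subsets n ] ∑[ κ ← words cs (suc n) ] g (b ∷ I) κ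
    ≡⟨ ∑-words bs (λ I → ∑[ κ ← words cs (suc n) ] g I κ) ⟨
  ∑[ I ← subsets (suc n) ] ∑[ κ ← words cs (suc n) ] g I κ ∎
  where
  bs : List Bool
  bs = true ∷ false ∷ []

  cs : List (Fin (suc k))
  cs = allFin (suc k)

  rest : Fin (suc (suc k)) → ℚ
  rest x = ∑[ I ← subsets n ] ∑[ κ ← words cs n ] (⟦ compatible? I κ ⟧ * f (x ∷ join I κ))

  g : Subset (suc n) → Vec (Fin (suc k)) (suc n) → ℚ
  g I κ = ⟦ compatible? I κ ⟧ * f (join I κ)

  combine : ∀ b c I κ → ⟦ compatibleColour? b c ⟧ * (⟦ compatible? I κ ⟧ * f (joinColour b c ∷ join I κ))
                      ≡ g (b ∷ I) (c ∷ κ)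
  combine b c I κ = trans (sym (ℚ.*-assoc ⟦ compatibleColour? b c ⟧ ⟦ compatible? I κ ⟧ _))
    (cong (_* f (joinColour b c ∷ join I κ)) (sym
      (⟦⟧-× (compatible? (b ∷ I) (c ∷ κ)) (compatibleColour? b c) (compatible? I κ)
        (λ comp → comp zero , comp ∘ suc) (λ p ps → λ { zero → p ; (suc v) → ps v }))))

∑-words-single : (x : A) (n : ℕ) (f : Vec A n → ℚ) → ∑ (words (x ∷ []) n) f ≡ f (Vec.replicate n x)
∑-words-single x zero    f = ℚ.+-identityʳ (f [])
∑-words-single x (suc n) f = trans (∑-words (x ∷ []) f)
  (trans (ℚ.+-identityʳ _) (∑-words-single x n (λ v → f (x ∷ v))))

∑-words-suc : ∀ n (f : Vec (Fin (suc k)) n → ℚ) → (∀ κ v → lookup κ v ≡ zero → f κ ≡ 0ℚ) →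
  ∑ (words (allFin (suc k)) n) f ≡ ∑[ κ ← words (allFin k) n ] f (Vec.map suc κ)
∑-words-suc zero f _ = refl
∑-words-suc {k} (suc n) f f≡0 = begin
  ∑ (words (allFin (suc k)) (suc n)) f
    ≡⟨ ∑-words (allFin (suc k)) f ⟩
  ∑[ x ← allFin (suc k) ] ∑[ κ ← words (allFin (suc k)) n ] f (x ∷ κ)
    ≡⟨ ∑-allFin-suc (λ x → ∑[ κ ← words (allFin (suc k)) n ] f (x ∷ κ)) ⟩
  ∑[ κ ← words (allFin (suc k)) n ] f (zero ∷ κ)
    + ∑[ c ← allFin k ] ∑[ κ ← words (allFin (suc k)) n ] f (suc c ∷ κ)
    ≡⟨ cong₂ _+_ (∑-zero (words (allFin (suc k)) n) λ κ → f≡0 (zero ∷ κ) zero refl)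
         (∑-cong (allFin k) λ c → ∑-words-suc n (λ κ → f (suc c ∷ κ)) λ κ v → f≡0 (suc c ∷ κ) (suc v)) ⟩
  0ℚ + ∑[ c ← allFin k ] ∑[ κ ← words (allFin k) n ] f (suc c ∷ Vec.map suc κ)
    ≡⟨ ℚ.+-identityˡ _ ⟩
  ∑[ c ← allFin k ] ∑[ κ ← words (allFin k) n ] f (suc c ∷ Vec.map suc κ)
    ≡⟨ ∑-words (allFin k) (f ∘ Vec.map suc) ⟨
  ∑[ κ ← words (allFin k) (suc n) ] f (Vec.map suc κ) ∎

-- Colourings of induced subgraphs

lookup-join : ∀ (I : Subset n) (κ : Vec (Fin (suc k)) n) v →
              lookup (join I κ) v ≡ joinColour (lookup I v) (lookup κ v)
lookup-join I κ v = Vec.lookup-zipWith joinColour v I κ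

∉⇒lookup : ∀ {I : Subset n} {v} → v S.∉ I → lookup I v ≡ false
∉⇒lookup {I = I} {v} v∉I with lookup I v in eq
... | false = refl
... | true  = ⊥-elim (v∉I (Vec.lookup⇒[]= v I eq))

join-∈ : ∀ {I : Subset n} (κ : Vec (Fin (suc k)) n) {v} → v S.∈ I → lookup (join I κ) v ≡ suc zero
join-∈ {I = I} κ {v} v∈I =
  trans (lookup-join I κ v) (cong (λ b → joinColour b (lookup κ v)) (Vec.[]=⇒lookup v∈I))

join-∉ : ∀ {I : Subset n} (κ : Vec (Fin (suc k)) n) {v} → v S.∉ I →
         lookup (join I κ) v ≡ punchIn (suc zero) (lookup κ v)
join-∉ {I = I} κ {v} v∉I =
  trans (lookup-join I κ v) (cong (λ b → joinColour b (lookup κ v)) (∉⇒lookup v∉I))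

x∈p─q⇒x∉q : ∀ {p q : Subset n} {v} → v S.∈ p ─ q → v S.∉ q
x∈p─q⇒x∉q {p = _ ∷ p} {true ∷ q} () Vec.here
x∈p─q⇒x∉q {p = _ ∷ p} {_ ∷ q} (Vec.there v∈) (Vec.there v∈q) = x∈p─q⇒x∉q v∈ v∈q

punchIn-zero : ∀ {c : Fin (suc k)} → punchIn (suc zero) c ≡ zero → c ≡ zero
punchIn-zero {c = zero} _ = refl

module _ (G : Graph n) where

  -- These are the proper colourings of the subgraph induced on `T` that use all of `k` colours.
  -- Extending them by zero outside `T` keeps the vertex set fixed, so deleting a colour class needs
  -- no relabelling; properness therefore exempts colour zero.
  record Colours (k : ℕ) (T : Subset n) (κ : Vec (Fin (suc k)) n) : Set where
    constructor colours
    field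
      coloured : ∀ v → v S.∈ T → lookup κ v ≢ zero
      support  : ∀ v → lookup κ v ≢ zero → v S.∈ T
      proper   : ∀ u v → Adj G u v → lookup κ u ≡ lookup κ v → lookup κ u ≡ zero
      onto     : ∀ i → ∃ λ v → lookup κ v ≡ suc i

  open Colours

  colours? : ∀ {k} T κ → Dec (Colours k T κ)
  colours? T κ = map′
    (λ { (a , b , c , d) → colours a b c d })
    (λ { (colours a b c d) → a , b , c , d })
    ((Fin.all? λ v → (v S.∈? T) →-dec ¬? (lookup κ v Fin.≟ zero))
     ×-dec (Fin.all? λ v → ¬? (lookup κ v Fin.≟ zero) →-dec (v S.∈? T))
     ×-dec (Fin.all? λ u → Fin.all? λ v → adj? G u v →-dec
              ((lookup κ u Fin.≟ lookup κ v) →-dec (lookup κ u Fin.≟ zero)))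
     ×-dec (Fin.all? λ i → Fin.any? λ v → lookup κ v Fin.≟ suc i))

  Stable : Subset n → Subset n → Set
  Stable U I = I S.⊆ U × Independent G I

  stable? : ∀ U I → Dec (Stable U I)
  stable? U I = (I S.⊆? U) ×-dec independent? G I

  module _ {T I : Subset n} {κ : Vec (Fin (suc k)) n} where

    -- Outside `I` the colours pass through `punchIn (suc zero)`, which is injective and misses
    -- `suc zero`, so `I` is exactly the first colour class: nonempty by surjectivity, independent
    -- by properness.
    join-colours⁻ : Compatible I κ → Colours (suc k) T (join I κ) →
                    (S.Nonempty I × Stable T I) × Colours k (T ─ I) κ
    join-colours⁻ comp jκ = (nonempty , I⊆T , indep) , record
      { coloured = λ v v∈ κv≡0 → coloured jκ v (S.p─q⊆p T I v∈)
          (trans (join-∉ κ (x∈p─q⇒x∉q v∈)) (cong (punchIn (suc zero)) κv≡0))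
      ; support = λ v κv≢0 → S.x∈p∧x∉q⇒x∈p─q
          (support jκ v (λ eq → κv≢0 (punchIn-zero (trans (sym (join-∉ κ (outside κv≢0))) eq))))
          (outside κv≢0)
      ; proper = λ u v uv eq → proper′ u v uv eq (lookup κ u Fin.≟ zero)
      ; onto = onto′
      }
      where
      outside : ∀ {v} → lookup κ v ≢ zero → v S.∉ I
      outside {v} κv≢0 v∈I = κv≢0 (comp v (Vec.[]=⇒lookup v∈I))

      nonempty : S.Nonempty I
      nonempty with onto jκ zero
      ... | v , eq with v S.∈? I
      ...   | yes v∈I = v , v∈I
      ...   | no  v∉I = ⊥-elim (Fin.punchInᵢ≢i (suc zero) (lookup κ v) (trans (sym (join-∉ κ v∉I)) eq))

      I⊆T : I S.⊆ T
      I⊆T {v} v∈I = support jκ v λ eq → Fin.0≢1+n (trans (sym eq) (join-∈ κ v∈I))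

      indep : Independent G I
      indep u v u∈I v∈I uv = Fin.0≢1+n (trans
        (sym (proper jκ u v uv (trans (join-∈ κ u∈I) (sym (join-∈ κ v∈I))))) (join-∈ κ u∈I))

      proper′ : ∀ u v → Adj G u v → lookup κ u ≡ lookup κ v → Dec (lookup κ u ≡ zero) → lookup κ u ≡ zero
      proper′ u v uv eq (yes κu≡0) = κu≡0
      proper′ u v uv eq (no κu≢0)  = punchIn-zero (trans (sym join-u) (proper jκ u v uv
        (trans join-u (trans (cong (punchIn (suc zero)) eq) (sym join-v)))))
        where
        join-u = join-∉ κ (outside κu≢0)
        join-v = join-∉ κ (outside (λ κv≡0 → κu≢0 (trans eq κv≡0)))

      onto′ : ∀ i → ∃ λ v → lookup κ v ≡ suc i
      onto′ i with onto jκ (suc i)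
      ... | v , eq with v S.∈? I
      ...   | yes v∈I = case trans (sym eq) (join-∈ κ v∈I) of λ ()
      ...   | no  v∉I = v , Fin.punchIn-injective (suc zero) (lookup κ v) (suc i) (trans (sym (join-∉ κ v∉I)) eq)

    join-colours⁺ : S.Nonempty I × Stable T I → Colours k (T ─ I) κ →
                    Compatible I κ × Colours (suc k) T (join I κ)
    join-colours⁺ ((x , x∈I) , I⊆T , indep) κ-ok = (λ v eq → zeroOn (Vec.lookup⇒[]= v I eq)) , record
      { coloured = λ v v∈T eq → coloured′ v v∈T eq (v S.∈? I)
      ; support  = λ v ≢0 → support′ v ≢0 (v S.∈? I)
      ; proper   = λ u v uv eq → proper′ u v uv eq (u S.∈? I) (v S.∈? I)
      ; onto     = λ { zero → x , join-∈ κ x∈I ; (suc i) → onto′ i }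
      }
      where
      zeroOn : ∀ {v} → v S.∈ I → lookup κ v ≡ zero
      zeroOn {v} v∈I with lookup κ v Fin.≟ zero
      ... | yes κv≡0 = κv≡0
      ... | no  κv≢0 = ⊥-elim (x∈p─q⇒x∉q (support κ-ok v κv≢0) v∈I)

      coloured′ : ∀ v → v S.∈ T → lookup (join I κ) v ≡ zero → Dec (v S.∈ I) → _
      coloured′ v v∈T eq (yes v∈I) = Fin.0≢1+n (trans (sym eq) (join-∈ κ v∈I))
      coloured′ v v∈T eq (no v∉I)  = coloured κ-ok v (S.x∈p∧x∉q⇒x∈p─q v∈T v∉I)
        (punchIn-zero (trans (sym (join-∉ κ v∉I)) eq))

      support′ : ∀ v → lookup (join I κ) v ≢ zero → Dec (v S.∈ I) → v S.∈ T
      support′ v ≢0 (yes v∈I) = I⊆T v∈I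
      support′ v ≢0 (no v∉I)  = S.p─q⊆p T I (support κ-ok v
        λ κv≡0 → ≢0 (trans (join-∉ κ v∉I) (cong (punchIn (suc zero)) κv≡0)))

      proper′ : ∀ u v → Adj G u v → lookup (join I κ) u ≡ lookup (join I κ) v →
                Dec (u S.∈ I) → Dec (v S.∈ I) → lookup (join I κ) u ≡ zero
      proper′ u v uv eq (yes u∈I) (yes v∈I) = ⊥-elim (indep u v u∈I v∈I uv)
      proper′ u v uv eq (yes u∈I) (no v∉I)  = ⊥-elim (Fin.punchInᵢ≢i (suc zero) (lookup κ v)
        (trans (sym (join-∉ κ v∉I)) (trans (sym eq) (join-∈ κ u∈I))))
      proper′ u v uv eq (no u∉I)  (yes v∈I) = ⊥-elim (Fin.punchInᵢ≢i (suc zero) (lookup κ u)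
        (trans (sym (join-∉ κ u∉I)) (trans eq (join-∈ κ v∈I))))
      proper′ u v uv eq (no u∉I)  (no v∉I)  = trans (join-∉ κ u∉I) (cong (punchIn (suc zero))
        (proper κ-ok u v uv (Fin.punchIn-injective (suc zero) _ _
          (trans (sym (join-∉ κ u∉I)) (trans eq (join-∉ κ v∉I))))))

      onto′ : ∀ i → ∃ λ v → lookup (join I κ) v ≡ suc (suc i)
      onto′ i with onto κ-ok i
      ... | v , eq = v , trans
        (join-∉ κ λ v∈I → Fin.0≢1+n (trans (sym (zeroOn v∈I)) eq))
        (cong (punchIn (suc zero)) eq)

  surjColourings : Subset n → ℕ → ℚ
  surjColourings T k = ∑[ κ ← words (allFin (suc k)) n ] ⟦ colours? {k} T κ ⟧

  surjColourings-suc : ∀ T k → surjColourings T (suc k) ≡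
    ∑[ I ← subsets n ] (⟦ S.nonempty? I ×-dec stable? T I ⟧ * surjColourings (T ─ I) k)
  surjColourings-suc T k = trans (∑-join n (λ κ → ⟦ colours? T κ ⟧))
    (∑-cong (subsets n) λ I → trans
      (∑-cong (words (allFin (suc k)) n) λ κ → trans
        (sym (⟦⟧-× (compatible? I κ ×-dec colours? T (join I κ)) (compatible? I κ) (colours? T (join I κ)) id _,_))
        (⟦⟧-× (compatible? I κ ×-dec colours? T (join I κ)) (S.nonempty? I ×-dec stable? T I) (colours? (T ─ I) κ)
          (uncurry join-colours⁻) join-colours⁺))
      (∑-*ˡ ⟦ S.nonempty? I ×-dec stable? T I ⟧ _ (words (allFin (suc k)) n)))

  surjColourings-zero : ∀ T → surjColourings T 0 ≡ ⟦ ¬? (S.nonempty? T) ⟧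
  surjColourings-zero T = trans (∑-words-single zero n (λ κ → ⟦ colours? T κ ⟧))
    (⟦⟧-cong (colours? T (Vec.replicate n zero)) (¬? (S.nonempty? T))
      (λ { c (v , v∈T) → coloured c v v∈T (all-zero v) })
      (λ ¬ne → record
        { coloured = λ v v∈T _ → ¬ne (v , v∈T)
        ; support  = λ v ≢0 → ⊥-elim (≢0 (all-zero v))
        ; proper   = λ u _ _ _ → all-zero u
        ; onto     = λ ()
        }))
    where
    all-zero : ∀ v → lookup (Vec.replicate n (zero {0})) v ≡ zero
    all-zero v = Vec.lookup-replicate v zero

-- Positivity of the signed count of colourings

sign : ℕ → ℚ → ℚ
sign zero    x = x
sign (suc m) x = - sign m x

sign-0 : ∀ m → sign m 0ℚ ≡ 0ℚ
sign-0 zero    = refl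
sign-0 (suc m) = cong -_ (sign-0 m)

sign-- : ∀ m x y → sign (suc m) (x - y) ≡ sign (suc m) x + sign m y
sign-- zero    x y = solve 2 (λ a b → :- (a :- b) := :- a :+ b) refl x y
sign-- (suc m) x y = trans (cong -_ (sign-- m x y))
  (solve 2 (λ a b → :- (:- a :+ b) := :- (:- a) :+ :- b) refl (sign m x) (sign m y))

sign-* : ∀ m c x → sign m (c * x) ≡ c * sign m x
sign-* zero    c x = refl
sign-* (suc m) c x = trans (cong -_ (sign-* m c x)) (ℚ.neg-distribʳ-* c (sign m x))

sign-summand : ∀ m {x y z} → x ≡ y + z → sign (suc m) y ≡ sign (suc m) x + sign m z
sign-summand m {x} {y} {z} refl = trans
  (cong (sign (suc m)) (solve 2 (λ y z → y := (y :+ z) :- z) refl y z)) (sign-- m x z)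

∣∣-remove : ∀ {T : Subset n} {v} → v S.∈ T → ∣ T ∣ ≡ suc ∣ T S.- v ∣
∣∣-remove {T = true ∷ T}  {zero}  Vec.here       = cong (suc ∘ ∣_∣) (sym (S.p─⊥≡p T))
∣∣-remove {T = true ∷ T}  {suc v} (Vec.there v∈) = cong suc (∣∣-remove v∈)
∣∣-remove {T = false ∷ T} {suc v} (Vec.there v∈) = ∣∣-remove v∈

empty⇒∣∣≡0 : ∀ {T : Subset n} → ¬ S.Nonempty T → ∣ T ∣ ≡ 0
empty⇒∣∣≡0 {n} ¬ne = trans (cong ∣_∣ (S.Empty-unique ¬ne)) (S.∣⊥∣≡0 n)

∣∣≡0⇒empty : ∀ {T : Subset n} → ∣ T ∣ ℕ.≤ 0 → ¬ S.Nonempty T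
∣∣≡0⇒empty le (v , v∈) = case ℕ.≤-trans (ℕ.≤-reflexive (sym (∣∣-remove v∈))) le of λ ()

module _ (G : Graph n) where

  -- The chromatic polynomial of the subgraph induced on `T` is Σ_k `surjColourings G T k` ·
  -- binom(q, k), and binom(-1, k) = (-1)^k. For N ≥ ∣T∣ this is therefore its value at -1.
  γ : ℕ → Subset n → ℚ
  γ N T = alt N (surjColourings G T)

  γ-suc : ∀ N T → γ (suc N) T ≡
    ⟦ ¬? (S.nonempty? T) ⟧ - ∑[ I ← subsets n ] (⟦ S.nonempty? I ×-dec stable? G T I ⟧ * γ N (T ─ I))
  γ-suc N T = cong₂ _-_ (surjColourings-zero G T)
    (trans (alt-cong N (surjColourings-suc G T))
           (alt-∑ N (λ I → ⟦ S.nonempty? I ×-dec stable? G T I ⟧) (λ I → surjColourings G (T ─ I)) (subsets n)))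

  ∣─∣< : ∀ {T I : Subset n} → S.Nonempty I × Stable G T I → ∣ T ─ I ∣ ℕ.< ∣ T ∣
  ∣─∣< {T} {I} ((v , v∈I) , I⊆T , _) =
    S.p∩q≢∅⇒∣p─q∣<∣p∣ T I (v , S.x∈p∩q⁺ (I⊆T v∈I , v∈I))

  -- A colouring of `T` using every colour has at most ∣T∣ colours, so later terms vanish. In the
  -- recursion this appears as the nonempty class removed at each step.
  γ-stable : ∀ N T → ∣ T ∣ ℕ.≤ N → γ (suc N) T ≡ γ N T
  γ-stable zero T le = begin
    γ 1 T
      ≡⟨ γ-suc 0 T ⟩
    ⟦ ¬? (S.nonempty? T) ⟧ - ∑[ I ← subsets n ] (⟦ S.nonempty? I ×-dec stable? G T I ⟧ * γ 0 (T ─ I))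
      ≡⟨ cong (λ x → ⟦ ¬? (S.nonempty? T) ⟧ - x) (∑-zero (subsets n) λ I → trans
           (cong (_* γ 0 (T ─ I)) (⟦⟧-no (S.nonempty? I ×-dec stable? G T I)
             λ { ((v , v∈I) , I⊆T , _) → ∣∣≡0⇒empty le (v , I⊆T v∈I) }))
           (ℚ.*-zeroˡ (γ 0 (T ─ I)))) ⟩
    ⟦ ¬? (S.nonempty? T) ⟧ - 0ℚ
      ≡⟨ ℚ.+-identityʳ _ ⟩
    ⟦ ¬? (S.nonempty? T) ⟧
      ≡⟨ surjColourings-zero G T ⟨
    γ 0 T ∎
  γ-stable (suc N) T le = trans (γ-suc (suc N) T) (trans
    (cong (λ x → ⟦ ¬? (S.nonempty? T) ⟧ - x) (∑-cong (subsets n) λ I →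
      ⟦⟧-guard (S.nonempty? I ×-dec stable? G T I) λ st →
        γ-stable N (T ─ I) (ℕ.s≤s⁻¹ (ℕ.≤-trans (∣─∣< st) le))))
    (sym (γ-suc N T)))

  -- Up to the sign (−1)^|T|, the number of acyclic orientations of the subgraph induced on T
  -- in which no vertex of U is a sink.
  η : Subset n → Subset n → ℚ
  η U T = ∑[ I ← subsets n ] (⟦ stable? G U I ⟧ * γ n (T ─ I))

  η-empty : ∀ U T → ¬ S.Nonempty U → η U T ≡ γ n T
  η-empty U T ¬ne = begin
    η U T
      ≡⟨ ∑-cong (subsets n) (λ I → cong (_* γ n (T ─ I)) (⟦⟧-cong (stable? G U I) (¬? (S.nonempty? I))
           (λ { (I⊆U , _) (v , v∈I) → ¬ne (v , I⊆U v∈I) })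
           (λ ¬neI → (λ v∈I → ⊥-elim (¬neI (_ , v∈I))) , λ u v u∈I → ⊥-elim (¬neI (u , u∈I))))) ⟩
    ∑[ I ← subsets n ] (⟦ ¬? (S.nonempty? I) ⟧ * γ n (T ─ I))
      ≡⟨ ∑-subsets-empty n (λ I → γ n (T ─ I)) ⟩
    γ n (T ─ S.⊥)
      ≡⟨ cong (γ n) (S.p─⊥≡p T) ⟩
    γ n T ∎

  -- An acyclic orientation of a nonempty graph has a sink. Algebraically this is the recursion
  -- `γ-suc` with all its terms on one side, the empty set supplying γ of `T` itself.
  η-full : ∀ T → η T T ≡ ⟦ ¬? (S.nonempty? T) ⟧
  η-full T = begin
    η T T
      ≡⟨ ∑-cong (subsets n) (λ I → sym (⟦⟧+⟦¬⟧ (S.nonempty? I) (term I))) ⟩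
    ∑[ I ← subsets n ] (⟦ S.nonempty? I ⟧ * term I + ⟦ ¬? (S.nonempty? I) ⟧ * term I)
      ≡⟨ ∑-+ _ _ (subsets n) ⟩
    ∑[ I ← subsets n ] (⟦ S.nonempty? I ⟧ * term I) + ∑[ I ← subsets n ] (⟦ ¬? (S.nonempty? I) ⟧ * term I)
      ≡⟨ cong₂ _+_
           (∑-cong (subsets n) λ I → trans
             (sym (ℚ.*-assoc ⟦ S.nonempty? I ⟧ ⟦ stable? G T I ⟧ (γ n (T ─ I))))
             (cong (_* γ n (T ─ I)) (sym (⟦⟧-× (S.nonempty? I ×-dec stable? G T I) (S.nonempty? I) (stable? G T I) id _,_))))
           (∑-subsets-empty n term) ⟩
    above + ⟦ stable? G T S.⊥ ⟧ * γ n (T ─ S.⊥)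
      ≡⟨ cong₂ (λ x y → above + x * y)
           (⟦⟧-yes (stable? G T S.⊥) ((λ v∈⊥ → ⊥-elim (S.∉⊥ v∈⊥)) , λ u v u∈⊥ → ⊥-elim (S.∉⊥ u∈⊥)))
           -- The recursion lowers the truncation bound by one. Passing first from n to n + 1, which
           -- stability allows, makes the remaining terms carry bound n as in `η`.
           (trans (cong (γ n) (S.p─⊥≡p T)) (trans (sym (γ-stable n T (S.∣p∣≤n T))) (γ-suc n T))) ⟩
    above + 1ℚ * (⟦ ¬? (S.nonempty? T) ⟧ - above)
      ≡⟨ solve 2 (λ a b → a :+ con 1ℚ :* (b :- a) := b) refl above ⟦ ¬? (S.nonempty? T) ⟧ ⟩
    ⟦ ¬? (S.nonempty? T) ⟧ ∎
    where
    term : Subset n → ℚ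
    term I = ⟦ stable? G T I ⟧ * γ n (T ─ I)

    above : ℚ
    above = ∑[ I ← subsets n ] (⟦ S.nonempty? I ×-dec stable? G T I ⟧ * γ n (T ─ I))

  nonNeighbours : Fin n → Subset n → Subset n
  nonNeighbours v U = Vec.tabulate λ u → does (u S.∈? U ×-dec ¬? (adj? G v u))

  ∈-nonNeighbours⁻ : ∀ {v U u} → u S.∈ nonNeighbours v U → u S.∈ U × ¬ Adj G v u
  ∈-nonNeighbours⁻ {v} {U} {u} u∈ = invert (u S.∈? U ×-dec ¬? (adj? G v u)) (trans
    (sym (Vec.lookup∘tabulate (λ u → does (u S.∈? U ×-dec ¬? (adj? G v u))) u)) (Vec.[]=⇒lookup u∈))
    where
    invert : (d : Dec P) → does d ≡ true → P
    invert (yes p) _ = p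

  ∈-nonNeighbours⁺ : ∀ {v U u} → u S.∈ U → ¬ Adj G v u → u S.∈ nonNeighbours v U
  ∈-nonNeighbours⁺ {v} {U} {u} u∈U ¬vu = Vec.lookup⇒[]= u _ (trans
    (Vec.lookup∘tabulate (λ u → does (u S.∈? U ×-dec ¬? (adj? G v u))) u)
    (dec-true (u S.∈? U ×-dec ¬? (adj? G v u)) (u∈U , ¬vu)))

  stable-insert⁻ : ∀ {v U I} → v S.∉ I → Stable G (⁅ v ⁆ ∪ U) (⁅ v ⁆ ∪ I) → Stable G (nonNeighbours v U) I
  stable-insert⁻ {v} {U} {I} v∉I (sub , indep) = sub′ , λ u w u∈I w∈I →
    indep u w (S.q⊆p∪q ⁅ v ⁆ I u∈I) (S.q⊆p∪q ⁅ v ⁆ I w∈I)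
    where
    sub′ : I S.⊆ nonNeighbours v U
    sub′ {u} u∈I = ∈-nonNeighbours⁺ {v} {U} u∈U
      (indep v u (S.p⊆p∪q I (S.x∈⁅x⁆ v)) (S.q⊆p∪q ⁅ v ⁆ I u∈I))
      where
      u∈U : u S.∈ U
      u∈U with S.x∈p∪q⁻ ⁅ v ⁆ U (sub (S.q⊆p∪q ⁅ v ⁆ I u∈I))
      ... | inj₁ u∈v = ⊥-elim (v∉I (subst (S._∈ I) (S.x∈⁅y⁆⇒x≡y v u∈v) u∈I))
      ... | inj₂ u∈U = u∈U

  stable-insert⁺ : ∀ {v U I} → Stable G (nonNeighbours v U) I → Stable G (⁅ v ⁆ ∪ U) (⁅ v ⁆ ∪ I)
  stable-insert⁺ {v} {U} {I} (sub , indep) = sub′ , indep′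
    where
    sub′ : ⁅ v ⁆ ∪ I S.⊆ ⁅ v ⁆ ∪ U
    sub′ u∈ with S.x∈p∪q⁻ ⁅ v ⁆ I u∈
    ... | inj₁ u∈v = S.p⊆p∪q U u∈v
    ... | inj₂ u∈I = S.q⊆p∪q ⁅ v ⁆ U (proj₁ (∈-nonNeighbours⁻ {v} {U} (sub u∈I)))

    indep′ : Independent G (⁅ v ⁆ ∪ I)
    indep′ u w u∈ w∈ uw with S.x∈p∪q⁻ ⁅ v ⁆ I u∈ | S.x∈p∪q⁻ ⁅ v ⁆ I w∈
    ... | inj₂ u∈I | inj₂ w∈I = indep u w u∈I w∈I uw
    ... | inj₁ u∈v | inj₂ w∈I =
      proj₂ (∈-nonNeighbours⁻ {v} {U} (sub w∈I)) (subst (λ x → Adj G x w) (S.x∈⁅y⁆⇒x≡y v u∈v) uw)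
    ... | inj₂ u∈I | inj₁ w∈v =
      proj₂ (∈-nonNeighbours⁻ {v} {U} (sub u∈I))
        (subst (λ x → Adj G x u) (S.x∈⁅y⁆⇒x≡y v w∈v) (Graph.sym G uw))
    ... | inj₁ u∈v | inj₁ w∈v =
      Graph.irrefl G (trans (S.x∈⁅y⁆⇒x≡y v u∈v) (sym (S.x∈⁅y⁆⇒x≡y v w∈v))) uw

  stable-∪⁻ : ∀ {v U I} → v S.∉ I → Stable G (⁅ v ⁆ ∪ U) I → Stable G U I
  stable-∪⁻ {v} {U} {I} v∉I (sub , indep) = sub′ , indep
    where
    sub′ : I S.⊆ U
    sub′ u∈I with S.x∈p∪q⁻ ⁅ v ⁆ U (sub u∈I)
    ... | inj₁ u∈v = ⊥-elim (v∉I (subst (S._∈ I) (S.x∈⁅y⁆⇒x≡y v u∈v) u∈I))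
    ... | inj₂ u∈U = u∈U

  -- The independent sets are split by whether they contain `v`. In terms of orientations, for v in
  -- T: among those without sinks in U, the ones with v a sink correspond to orientations of T - v.
  -- Neighbours of v point to v and so are never sinks, which leaves only the non-neighbours in U to
  -- be constrained.
  η-insert : ∀ v U T → v S.∉ U → η (⁅ v ⁆ ∪ U) T ≡ η U T + η (nonNeighbours v U) (T S.- v)
  η-insert v U T v∉U = begin
    η (⁅ v ⁆ ∪ U) T
      ≡⟨ ∑-subsets-split v (λ I → ⟦ stable? G (⁅ v ⁆ ∪ U) I ⟧ * γ n (T ─ I)) ⟩
    ∑[ I ← subsets n ] (⟦ ¬? (v S.∈? I) ⟧ *
      (⟦ stable? G (⁅ v ⁆ ∪ U) I ⟧ * γ n (T ─ I) + ⟦ stable? G (⁅ v ⁆ ∪ U) (⁅ v ⁆ ∪ I) ⟧ * γ n (T ─ (⁅ v ⁆ ∪ I))))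
      ≡⟨ ∑-cong (subsets n) (λ I → trans
           (solve 5 (λ a b c d e → a :* (b :* c :+ d :* e) := (a :* b) :* c :+ (a :* d) :* e) refl
             ⟦ ¬? (v S.∈? I) ⟧ ⟦ stable? G (⁅ v ⁆ ∪ U) I ⟧ (γ n (T ─ I))
             ⟦ stable? G (⁅ v ⁆ ∪ U) (⁅ v ⁆ ∪ I) ⟧ (γ n (T ─ (⁅ v ⁆ ∪ I))))
           (cong₂ _+_
             (cong (_* γ n (T ─ I)) (sym (⟦⟧-× (stable? G U I) (¬? (v S.∈? I)) (stable? G (⁅ v ⁆ ∪ U) I)
               (λ { (sub , indep) → (λ v∈I → v∉U (sub v∈I)) , (λ u∈I → S.q⊆p∪q ⁅ v ⁆ U (sub u∈I)) , indep })
               stable-∪⁻)))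
             (cong₂ _*_ (sym (⟦⟧-× (stable? G (nonNeighbours v U) I) (¬? (v S.∈? I)) (stable? G (⁅ v ⁆ ∪ U) (⁅ v ⁆ ∪ I))
                 (λ st → (λ v∈I → v∉U (proj₁ (∈-nonNeighbours⁻ {v} {U} (proj₁ st v∈I)))) , stable-insert⁺ st)
                 stable-insert⁻))
               (cong (γ n) (sym (S.p─q─r≡p─q∪r T ⁅ v ⁆ I)))))) ⟩
    ∑[ I ← subsets n ] (⟦ stable? G U I ⟧ * γ n (T ─ I)
      + ⟦ stable? G (nonNeighbours v U) I ⟧ * γ n (T S.- v ─ I))
      ≡⟨ ∑-+ _ _ (subsets n) ⟩
    η U T + η (nonNeighbours v U) (T S.- v) ∎

  η-remove : ∀ {m} v U T → v S.∉ U → sign (suc m) (η U T) ≡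
             sign (suc m) (η (⁅ v ⁆ ∪ U) T) + sign m (η (nonNeighbours v U) (T S.- v))
  η-remove {m} v U T v∉U = sign-summand m (η-insert v U T v∉U)

  -- Induction on ∣ T ∣, and for fixed T on a list of the vertices of T missing from U: by η-remove
  -- both the larger U and the smaller T contribute with the right sign.
  η-nonNeg : ∀ m T → ∣ T ∣ ≡ m → ∀ U → U S.⊆ T → (vs : List (Fin n)) →
             (∀ {v} → v S.∈ T → v S.∉ U → v ∈ vs) → 0ℚ ≤ sign m (η U T)
  η-nonNeg m T eq U U⊆T [] missing = subst (λ U → 0ℚ ≤ sign m (η U T)) (S.⊆-antisym T⊆U U⊆T) full
    where
    T⊆U : T S.⊆ U
    T⊆U {v} v∈T with v S.∈? U
    ... | yes v∈U = v∈U
    ... | no  v∉U = case missing v∈T v∉U of λ ()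

    indicator : (T? : Dec (S.Nonempty T)) → 0ℚ ≤ sign m ⟦ ¬? T? ⟧
    indicator (yes _)  = ℚ.≤-reflexive (sym (sign-0 m))
    indicator (no ¬ne) = subst (λ j → 0ℚ ≤ sign j 1ℚ) (trans (sym (empty⇒∣∣≡0 ¬ne)) eq) (ℚ.nonNegative⁻¹ 1ℚ)

    full : 0ℚ ≤ sign m (η T T)
    full = subst (λ x → 0ℚ ≤ sign m x) (sym (η-full T)) (indicator (S.nonempty? T))
  η-nonNeg m T eq U U⊆T (v ∷ vs) missing with v S.∈? T | v S.∈? U
  ... | no v∉T | _ = η-nonNeg m T eq U U⊆T vs λ u∈T u∉U → case missing u∈T u∉U of λ
    { (here refl) → ⊥-elim (v∉T u∈T) ; (there u∈vs) → u∈vs }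
  ... | yes _ | yes v∈U = η-nonNeg m T eq U U⊆T vs λ u∈T u∉U → case missing u∈T u∉U of λ
    { (here refl) → ⊥-elim (u∉U v∈U) ; (there u∈vs) → u∈vs }
  η-nonNeg zero T eq U U⊆T (v ∷ vs) missing | yes v∈T | no v∉U = case trans (sym (∣∣-remove v∈T)) eq of λ ()
  η-nonNeg (suc m) T eq U U⊆T (v ∷ vs) missing | yes v∈T | no v∉U =
    subst (0ℚ ≤_) (sym (η-remove {m} v U T v∉U)) (ℚ.+-mono-≤
      (η-nonNeg (suc m) T eq (⁅ v ⁆ ∪ U) vU⊆T vs missing′)
      (η-nonNeg m (T S.- v) (ℕ.suc-injective (trans (sym (∣∣-remove v∈T)) eq)) (nonNeighbours v U) sub
        (allFin n) (λ {u} _ _ → ∈.∈-allFin u)))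
    where
    vU⊆T : ⁅ v ⁆ ∪ U S.⊆ T
    vU⊆T u∈ with S.x∈p∪q⁻ ⁅ v ⁆ U u∈
    ... | inj₁ u∈v = subst (S._∈ T) (sym (S.x∈⁅y⁆⇒x≡y v u∈v)) v∈T
    ... | inj₂ u∈U = U⊆T u∈U

    missing′ : ∀ {u} → u S.∈ T → u S.∉ ⁅ v ⁆ ∪ U → u ∈ vs
    missing′ u∈T u∉vU with missing u∈T (u∉vU ∘ S.q⊆p∪q ⁅ v ⁆ U)
    ... | here refl  = ⊥-elim (u∉vU (S.p⊆p∪q U (S.x∈⁅x⁆ v)))
    ... | there u∈vs = u∈vs

    sub : nonNeighbours v U S.⊆ T S.- v
    sub {u} u∈ with ∈-nonNeighbours⁻ {v} {U} u∈
    ... | u∈U , _ = S.x∈p∧x∉q⇒x∈p─q (U⊆T u∈U)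
      λ u∈v → v∉U (subst (S._∈ U) (S.x∈⁅y⁆⇒x≡y v u∈v) u∈U)

  -- The acyclic orientations in which a chosen vertex v is a sink are those of T - v, and there is
  -- at least one by induction. The remaining ones are counted by η for the set consisting of v,
  -- which `η-nonNeg` bounds below by 0.
  γ-pos : ∀ m T → ∣ T ∣ ≡ m → 0ℚ < sign m (γ n T)
  γ-pos zero T eq = subst (0ℚ <_) (sym γ≡1) (ℚ.positive⁻¹ 1ℚ)
    where
    ¬ne : ¬ S.Nonempty T
    ¬ne = ∣∣≡0⇒empty (ℕ.≤-reflexive eq)

    γ≡1 : γ n T ≡ 1ℚ
    γ≡1 = trans (sym (η-empty T T ¬ne)) (trans (η-full T) (⟦⟧-yes (¬? (S.nonempty? T)) ¬ne))
  γ-pos (suc m) T eq with S.nonempty? T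
  ... | no ¬ne = case trans (sym (empty⇒∣∣≡0 ¬ne)) eq of λ ()
  ... | yes (v , v∈T) = subst (0ℚ <_) (sym expand) (ℚ.+-mono-≤-<
    (η-nonNeg (suc m) T eq (⁅ v ⁆ ∪ S.⊥) sub (allFin n) (λ {u} _ _ → ∈.∈-allFin u))
    (γ-pos m (T S.- v) (ℕ.suc-injective (trans (sym (∣∣-remove v∈T)) eq))))
    where
    sub : ⁅ v ⁆ ∪ S.⊥ S.⊆ T
    sub u∈ with S.x∈p∪q⁻ ⁅ v ⁆ S.⊥ u∈
    ... | inj₁ u∈v = subst (S._∈ T) (sym (S.x∈⁅y⁆⇒x≡y v u∈v)) v∈T
    ... | inj₂ u∈⊥ = ⊥-elim (S.∉⊥ u∈⊥)

    expand : sign (suc m) (γ n T) ≡ sign (suc m) (η (⁅ v ⁆ ∪ S.⊥) T) + sign m (γ n (T S.- v))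
    expand = begin
      sign (suc m) (γ n T)
        ≡⟨ cong (sign (suc m)) (η-empty S.⊥ T λ (_ , u∈⊥) → S.∉⊥ u∈⊥) ⟨
      sign (suc m) (η S.⊥ T)
        ≡⟨ η-remove {m} v S.⊥ T S.∉⊥ ⟩
      sign (suc m) (η (⁅ v ⁆ ∪ S.⊥) T) + sign m (η (nonNeighbours v S.⊥) (T S.- v))
        ≡⟨ cong (λ x → sign (suc m) (η (⁅ v ⁆ ∪ S.⊥) T) + sign m x)
             (η-empty (nonNeighbours v S.⊥) (T S.- v) λ (_ , u∈) → S.∉⊥ (proj₁ (∈-nonNeighbours⁻ {v} {S.⊥} u∈))) ⟩
      sign (suc m) (η (⁅ v ⁆ ∪ S.⊥) T) + sign m (γ n (T S.- v)) ∎

-- The coefficient of s_{(1ⁿ)} and the independence number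

∈-toList⁻ : ∀ {x : A} (xs : Vec A n) → x ∈ toList xs → ∃ λ v → lookup xs v ≡ x
∈-toList⁻ (y ∷ xs) (here refl) = zero , refl
∈-toList⁻ (y ∷ xs) (there x∈)  = let v , eq = ∈-toList⁻ xs x∈ in suc v , eq

lookup-∈-toList : ∀ (xs : Vec A n) v → lookup xs v ∈ toList xs
lookup-∈-toList (y ∷ xs) zero    = here refl
lookup-∈-toList (y ∷ xs) (suc v) = there (lookup-∈-toList xs v)

-- With all vertices in the set, colour zero cannot occur; dropping it and shifting the others down
-- gives the ordinary proper colourings.
surjColourings-⊤ : (G : Graph n) → ∀ k → surjColourings G S.⊤ k ≡
  ∑[ κ ← words (allFin k) n ] (⟦ proper? G κ ⟧ * ⟦ full? (toList κ) ⟧)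
surjColourings-⊤ {n} G k = trans
  (∑-words-suc n (λ κ → ⟦ colours? G S.⊤ κ ⟧) λ κ v eq →
    ⟦⟧-no (colours? G S.⊤ κ) λ c → Colours.coloured c v S.∈⊤ eq)
  (∑-cong (words (allFin k) n) λ κ → ⟦⟧-× (colours? G S.⊤ (Vec.map suc κ)) (proper? G κ) (full? (toList κ))
    (λ c → (λ u v uv eq → case trans (sym (lookup-suc κ u)) (Colours.proper c u v uv
              (trans (lookup-suc κ u) (trans (cong suc eq) (sym (lookup-suc κ v))))) of λ ())
         , (λ i → let v , eq = Colours.onto c i in
              subst (_∈ toList κ) (Fin.suc-injective (trans (sym (lookup-suc κ v)) eq)) (lookup-∈-toList κ v)))
    (λ prop full → record
      { coloured = λ v _ eq → case trans (sym (lookup-suc κ v)) eq of λ ()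
      ; support  = λ _ _ → S.∈⊤
      ; proper   = λ u v uv eq → ⊥-elim (prop u v uv (Fin.suc-injective
          (trans (sym (lookup-suc κ u)) (trans eq (lookup-suc κ v)))))
      ; onto     = λ i → let v , eq = ∈-toList⁻ κ (full i) in v , trans (lookup-suc κ v) (cong suc eq)
      }))
  where
  lookup-suc : (κ : Vec (Fin k) n) (v : Fin n) → lookup (Vec.map suc κ) v ≡ suc (lookup κ v)
  lookup-suc κ v = Vec.lookup-map v suc κ

φ-X : (G : Graph n) → φ n (X G) ≡ γ G n S.⊤
φ-X {n} G = alt-cong n λ k → trans
  (∑-content toList (All.universal (λ κ → ℕ.≤-reflexive (Vec.length-toList κ)) (filter (proper? G) (words (allFin k) n))))
  (trans (∑-filter (proper? G) (λ κ → ⟦ full? (toList κ) ⟧) (words (allFin k) n))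
         (sym (surjColourings-⊤ G k)))

partitions-IsPartition : ∀ n → All (IsPartition n) (partitions n)
partitions-IsPartition n = All.all-filter (isPartition? n)
  (concatMap (λ l → map toList (words (upTo (suc n)) l)) (upTo (suc n)))

-- The terms other than (1ⁿ) vanish whatever their coefficient, so every coefficient may be replaced
-- by that of (1ⁿ) and factored out. What remains is independent of F, and it need not be known how
-- often (1ⁿ) is listed in `partitions n`.
φ-expansion : ∀ n {F} (e : SchurExpansion n F) →
              φ n F ≡ coeff e (1^ n) * ∑[ λs ← partitions n ] φ n (schur λs)
φ-expansion n {F} e = begin
  φ n F
    ≡⟨ alt-cong n (λ k → trans
         (∑-cong (words (parts n) k) (expands e k))
         (trans (∑-swap (λ a λs → coeff e λs * schur λs k a) (words (parts n) k) (partitions n))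
                (∑-cong (partitions n) λ λs → ∑-*ˡ (coeff e λs) (schur λs k) (words (parts n) k)))) ⟩
  alt n (λ k → ∑[ λs ← partitions n ] (coeff e λs * ∑ (words (parts n) k) (schur λs k)))
    ≡⟨ alt-∑ n (coeff e) (λ λs k → ∑ (words (parts n) k) (schur λs k)) (partitions n) ⟩
  ∑[ λs ← partitions n ] (coeff e λs * φ n (schur λs))
    ≡⟨ ∑-cong-All (All.map (λ {λs} part → only-1ⁿ λs part (List.≡-dec ℕ._≟_ λs (1^ n))) (partitions-IsPartition n)) ⟩
  ∑[ λs ← partitions n ] (coeff e (1^ n) * φ n (schur λs))
    ≡⟨ ∑-*ˡ (coeff e (1^ n)) (λ λs → φ n (schur λs)) (partitions n) ⟩
  coeff e (1^ n) * ∑[ λs ← partitions n ] φ n (schur λs) ∎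
  where
  cancel : ∀ c d {x} → x ≡ 0ℚ → c * x ≡ d * x
  cancel c d refl = trans (ℚ.*-zeroʳ c) (sym (ℚ.*-zeroʳ d))

  only-1ⁿ : ∀ λs → IsPartition n λs → Dec (λs ≡ 1^ n) →
            coeff e λs * φ n (schur λs) ≡ coeff e (1^ n) * φ n (schur λs)
  only-1ⁿ λs part (yes eq)  = cong (λ μ → coeff e μ * φ n (schur λs)) eq
  only-1ⁿ λs part (no ≢1ⁿ) = cancel (coeff e λs) (coeff e (1^ n)) (φ-schur-0 n λs part ≢1ⁿ)

-- Colourings with one prescribed colour class

∈-words : ∀ {xs : List A} → (∀ x → x ∈ xs) → (v : Vec A n) → v ∈ words xs n
∈-words all []      = here refl
∈-words all (x ∷ v) = ∈.∈-cartesianProductWith⁺ _∷_ (all x) (∈-words all v)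

∈-subsets : (I : Subset n) → I ∈ subsets n
∈-subsets = ∈-words λ { true → here refl ; false → there (here refl) }

independent-≤α : (G : Graph n) {I : Subset n} → Independent G I → ∣ I ∣ ℕ.≤ α G
independent-≤α {n} G {I} indep = All.lookup (xs≤max 0 _)
  (∈.∈-map⁺ ∣_∣ (∈.∈-filter⁺ (independent? G) (∈-subsets I) indep))

α-attained : (G : Graph n) → ∃ λ I → Independent G I × ∣ I ∣ ≡ α G
α-attained {n} G with argmax-sel id 0 (map ∣_∣ (filter (independent? G) (subsets n)))
-- The maximum may be its default value 0, which the empty set attains.
... | inj₁ α≡0 = S.⊥ , (λ u v u∈⊥ → ⊥-elim (S.∉⊥ u∈⊥)) , trans (S.∣⊥∣≡0 n) (sym α≡0)
... | inj₂ α∈  with ∈.∈-map⁻ ∣_∣ α∈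
...   | I , I∈ , eq = I , proj₂ (∈.∈-filter⁻ (independent? G) {xs = subsets n} I∈) , sym eq

firstClass : Vec (Fin (suc k)) n → Subset n
firstClass = Vec.map (λ c → does (zero Fin.≟ c))

∣firstClass∣ : (κ : Vec (Fin (suc k)) n) → ∣ firstClass κ ∣ ≡ length (filter (zero Fin.≟_) (toList κ))
∣firstClass∣ []          = refl
∣firstClass∣ (zero ∷ κ)  = cong suc (∣firstClass∣ κ)
∣firstClass∣ (suc c ∷ κ) = ∣firstClass∣ κ

firstClass-zero : ∀ (κ : Vec (Fin (suc k)) n) {v} → v S.∈ firstClass κ → lookup κ v ≡ zero
firstClass-zero (zero ∷ κ) Vec.here       = refl
firstClass-zero (_ ∷ κ)    (Vec.there v∈) = firstClass-zero κ v∈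

firstClass-independent : (G : Graph n) (κ : Vec (Fin (suc k)) n) → Proper G κ → Independent G (firstClass κ)
firstClass-independent G κ prop u v u∈ v∈ uv =
  prop u v uv (trans (firstClass-zero κ u∈) (sym (firstClass-zero κ v∈)))

classColouring : Subset n → Vec (Fin (suc n)) n
classColouring I = Vec.tabulate λ v → if lookup I v then zero else suc v

firstClass-classColouring : (I : Subset n) → firstClass (classColouring I) ≡ I
firstClass-classColouring I = trans
  (sym (Vec.tabulate-∘ (λ c → does (zero Fin.≟ c)) (λ v → if lookup I v then zero else suc v)))
  (trans (Vec.tabulate-cong λ v → cases (lookup I v)) (Vec.tabulate∘lookup I))
  where
  cases : ∀ {k} {c : Fin k} b → does (zero Fin.≟ (if b then zero else suc c)) ≡ b
  cases true  = refl
  cases false = refl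

classColouring-proper : (G : Graph n) {I : Subset n} → Independent G I → Proper G (classColouring I)
classColouring-proper G {I} indep u v uv eq = cases (lookup I u) (lookup I v) refl refl
  (trans (sym (Vec.lookup∘tabulate _ u)) (trans eq (Vec.lookup∘tabulate _ v)))
  where
  cases : ∀ b c → lookup I u ≡ b → lookup I v ≡ c → (if b then zero else suc u) ≡ (if c then zero else suc v) → _
  cases true  true  Iu Iv _  = indep u v (Vec.lookup⇒[]= u I Iu) (Vec.lookup⇒[]= v I Iv) uv
  cases false false _  _  eq = Graph.irrefl G (Fin.suc-injective eq) uv

0≤fromℕ : ∀ m → 0ℚ ≤ fromℕ m
0≤fromℕ m = ℚ.nonNegative⁻¹ (fromℕ m) {{ℚ.normalize-nonNeg m 1}}

0<fromℕ : ∀ {m} → 0 ℕ.< m → 0ℚ < fromℕ m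
0<fromℕ {suc m} _ = ℚ.positive⁻¹ (fromℕ (suc m)) {{ℚ.normalize-pos (suc m) 1}}

X-classColouring-pos : (G : Graph n) {I : Subset n} → Independent G I →
                       0ℚ < X G (suc n) (content (toList (classColouring I)))
X-classColouring-pos {n} G {I} indep = 0<fromℕ (length-filter>0 (λ κ → Vec.≡-dec ℕ._≟_ (content (toList κ)) a)
  (∈.∈-filter⁺ (proper? G) (∈-words ∈.∈-allFin (classColouring I)) (classColouring-proper G indep)) refl)
  where a = content (toList (classColouring I))

-- The first exponent of this monomial is ∣I∣, so a contributing proper colouring would have an
-- independent first class with more than α(G) vertices.
X-classColouring-0 : (G : Graph n) {I : Subset n} → α G ℕ.< ∣ I ∣ →
                     X G (suc n) (content (toList (classColouring I))) ≡ 0ℚ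
X-classColouring-0 {n} G {I} α<∣I∣ = cong (fromℕ ∘ length) (List.filter-none _
  (All.map (λ {κ} prop eq → ℕ.<⇒≱ α<∣I∣ (subst (ℕ._≤ α G) (size κ eq)
      (independent-≤α G (firstClass-independent G κ prop))))
    (All.all-filter (proper? G) (words (allFin (suc n)) n))))
  where
  size : ∀ κ → content (toList κ) ≡ content (toList (classColouring I)) → ∣ firstClass κ ∣ ≡ ∣ I ∣
  size κ eq = begin
    ∣ firstClass κ ∣
      ≡⟨ ∣firstClass∣ κ ⟩
    length (filter (zero Fin.≟_) (toList κ))
      -- The head of a content vector is the multiplicity of colour `zero`.
      ≡⟨ cong Vec.head eq ⟩
    length (filter (zero Fin.≟_) (toList (classColouring I)))
      ≡⟨ ∣firstClass∣ (classColouring I) ⟨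
    ∣ firstClass (classColouring I) ∣
      ≡⟨ cong ∣_∣ (firstClass-classColouring I) ⟩
    ∣ I ∣ ∎

-- Sign of the scalar and comparison of coefficients

<⇒≱ : ∀ {p q} → p < q → ¬ q ≤ p
<⇒≱ p<q q≤p = ℚ.<-irrefl refl (ℚ.<-≤-trans p<q q≤p)

0≤* : ∀ {p q} → 0ℚ ≤ p → 0ℚ ≤ q → 0ℚ ≤ p * q
0≤* {p} {q} 0≤p 0≤q = ℚ.nonNegative⁻¹ (p * q)
  {{ℚ.nonNeg*nonNeg⇒nonNeg p {{ℚ.nonNegative 0≤p}} q {{ℚ.nonNegative 0≤q}}}}

0<* : ∀ {p q} → 0ℚ < p → 0ℚ < q → 0ℚ < p * q
0<* {p} {q} 0<p 0<q = ℚ.positive⁻¹ (p * q)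
  {{ℚ.pos*pos⇒pos p {{ℚ.positive 0<p}} q {{ℚ.positive 0<q}}}}

÷₀-pos : ∀ p q c → 0ℚ < p * c → 0ℚ < q * c → 0ℚ < p ÷₀ q
÷₀-pos p q c 0<pc 0<qc with q ℚ.≟ 0ℚ
... | yes refl = ⊥-elim (ℚ.<-irrefl (sym (ℚ.*-zeroˡ c)) 0<qc)
... | no q≢0   = ℚ.≰⇒> λ r≤0 → <⇒≱ 0<pc (ℚ.≤-trans (ℚ.≤-reflexive (sym rqc≡pc))
  (ℚ.≤-trans (ℚ.*-monoʳ-≤-nonNeg (q * c) {{ℚ.nonNegative (ℚ.<⇒≤ 0<qc)}} r≤0)
             (ℚ.≤-reflexive (ℚ.*-zeroˡ (q * c)))))
  where
  instance _ = ℚ.≢-nonZero q≢0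

  rqc≡pc : (p ℚ.÷ q) * (q * c) ≡ p * c
  rqc≡pc = begin
    p * (ℚ.1/ q) * (q * c)
      ≡⟨ solve 4 (λ p r q c → p :* r :* (q :* c) := p :* (r :* q) :* c) refl p (ℚ.1/ q) q c ⟩
    p * ((ℚ.1/ q) * q) * c
      ≡⟨ cong (λ x → p * x * c) (ℚ.*-inverseˡ q) ⟩
    p * 1ℚ * c
      ≡⟨ cong (_* c) (ℚ.*-identityʳ p) ⟩
    p * c ∎

schur-nonNeg : ∀ λs k a → 0ℚ ≤ schur λs k a
schur-nonNeg λs k a = 0≤fromℕ (length
  (filter (λ T → Vec.≡-dec ℕ._≟_ (content (concat T)) a) (filter semiStandard? (fillings k λs))))

SchurPositive⇒0≤ : ∀ {F} → SchurPositive n F → ∀ k a → 0ℚ ≤ F k a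
SchurPositive⇒0≤ {n} (e , pos) k a = subst (0ℚ ≤_) (sym (expands e k a))
  (∑-nonNeg (All.map (λ {λs} part → 0≤* (pos λs part) (schur-nonNeg λs k a)) (partitions-IsPartition n)))

-- φ of X_G is computed in two ways, from colourings and from the given expansion. The second factor
-- does not depend on the graph, so the same one serves for G and H.
coeff-1ⁿ-pos : (G : Graph n) (e : SchurExpansion n (X G)) →
               0ℚ < coeff e (1^ n) * sign n (∑[ λs ← partitions n ] φ n (schur λs))
coeff-1ⁿ-pos {n} G e = subst (0ℚ <_) (begin
  sign n (γ G n S.⊤)
    ≡⟨ cong (sign n) (φ-X G) ⟨
  sign n (φ n (X G))
    ≡⟨ cong (sign n) (φ-expansion n e) ⟩
  sign n (coeff e (1^ n) * total)
    ≡⟨ sign-* n (coeff e (1^ n)) total ⟩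
  coeff e (1^ n) * sign n total ∎) (γ-pos G n S.⊤ (S.∣⊤∣≡n n))
  where
  total : ℚ
  total = ∑[ λs ← partitions n ] φ n (schur λs)

difference<0 : ∀ {x y c} → x ≡ 0ℚ → 0ℚ < c → 0ℚ < y → x - c * y < 0ℚ
difference<0 {y = y} {c} refl 0<c 0<y =
  subst (_< 0ℚ) (sym (ℚ.+-identityˡ (- (c * y)))) (ℚ.neg-antimono-< (0<* 0<c 0<y))

Xₛ<0 : (G H : Graph n) (eG : SchurExpansion n (X G)) (eH : SchurExpansion n (X H)) →
       ∀ k a → X G k a ≡ 0ℚ → 0ℚ < X H k a → Xₛ G H eG eH k a < 0ℚ
Xₛ<0 {n} G H eG eH k a XG≡0 0<XH = difference<0 {X G k a} {X H k a} XG≡0 0<c 0<XH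
  where
  0<c : 0ℚ < coeff eG (1^ n) ÷₀ coeff eH (1^ n)
  0<c = ÷₀-pos (coeff eG (1^ n)) (coeff eH (1^ n)) (sign n (∑[ λs ← partitions n ] φ n (schur λs)))
    (coeff-1ⁿ-pos G eG) (coeff-1ⁿ-pos H eH)

proposition4p1 : (n : ℕ) (G H : Graph n) → Connected G → Connected H → G ≥ₛ H → α G ≥ α H
proposition4p1 n G H _ _ (eG , eH , pos) = ℕ.≮⇒≥ (αG≮αH (α-attained H))
  where
  αG≮αH : (∃ λ I → Independent H I × ∣ I ∣ ≡ α H) → ¬ α G ℕ.< α H
  αG≮αH (I , indep , ∣I∣≡αH) α< = <⇒≱ {Xₛ G H eG eH (suc n) a} {0ℚ}
    (Xₛ<0 G H eG eH (suc n) a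
      (X-classColouring-0 G {I} (subst (α G ℕ.<_) (sym ∣I∣≡αH) α<)) (X-classColouring-pos H {I} indep))
    (SchurPositive⇒0≤ pos (suc n) a)
    where
    a : Vec ℕ (suc n)
    a = content (toList (classColouring I))
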